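{- For each positive integer $n$, let $h(n)$ denote the smallest number of distinct lines in a $1$-$2$ metric space on $n$ points (the minimum over all such spaces). Then, as $n\to\infty$, \[ (1+o(1))\,\alpha\, n^{4/3}\;\le\; h(n)\;\le\;(1+o(1))\,\beta\, n^{4/3} \] with $\alpha=2^{ -7/3}$ and $\beta=3\cdot 2^{ -5/3}$.
   Context: A $1$-$2$ metric space is a metric space in which each nonzero distance equals $1$ or $2$. For points $a,b,c$ of a metric space $(X,d)$, write $[abc]$ if $a,b,c$ are three distinct points and $d(a,b)+d(b,c)=d(a,c)$. For any two distinct points $u,v\in X$, the line $\overline{uv}$ is the set $\{p:[puv]\}\cup\{u\}\cup\{p:[upv]\}\cup\{v\}\cup\{p:[uvp]\}$. The lines of $(X,d)$ are the sets $\overline{uv}$ with $u,v$ ranging over pairs of distinct points; distinct lines are counted as distinct subsets of $X$. -}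

module Defs where

open import Data.Bool.Base using (Bool; true; false; T; if_then_else_)
import Data.Bool.Properties as Bool
open import Data.Fin.Base using (Fin; zero; suc; funToFin; finToFun)
open import Data.Fin.Properties using (_≟_; finToFun-funToFin)
open import Data.Fin.Subset using (Subset)
open import Data.Integer.Base as ℤ using (ℤ; +_; -[1+_])
import Data.Integer.Properties as ℤ
open import Data.List.Base
  using (List; length; map; filter; deduplicate; allFin; cartesianProduct)
open import Data.List.Extrema.Nat using (argmin; f[argmin]≤f[xs])
open import Data.List.Membership.Propositional.Properties using (∈-map⁺; ∈-allFin)
import Data.List.Properties as List
import Data.List.Relation.Unary.All as All
open import Data.Nat.Base as ℕ using (ℕ; zero; suc; NonZero)
import Data.Nat.Properties as ℕ
open import Algebra.Properties.CommutativeSemigroup ℕ.*-commutativeSemigroup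
  using (interchange)
open import Data.Product.Base using (_×_; _,_; ∃-syntax; proj₁; proj₂; uncurry)
open import Data.Rational.Unnormalised.Base as ℚ
  using (ℚᵘ; mkℚᵘ; _/_; 0ℚᵘ; 1ℚᵘ; ½; *≡*; *≤*)
import Data.Rational.Unnormalised.Properties as ℚ
open import Data.Rational.Unnormalised.Solver using (module +-*-Solver)
open import Data.Sum.Base using (_⊎_; inj₁; inj₂)
open import Data.Vec.Base using (tabulate)
open import Data.Vec.Properties using (≡-dec; tabulate-cong)
open import Function.Base using (_∘_)
open import Function.Metric.Nat.Core using (DistanceFunction)
open import Function.Metric.Nat.Structures using (IsMetric)
open import Relation.Binary.PropositionalEquality
  using (_≡_; _≢_; refl; sym; trans; cong; cong₂; subst; subst₂; isEquivalence)
open import Relation.Nullary.Decidable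
  using (Dec; yes; no; does; ¬?; _×-dec_; _⊎-dec_)
open import Relation.Nullary.Negation using (contradiction)

-- All distances lie in {0,1,2}, so taking them in ℕ loses nothing; a
-- space on n points has, up to isometry, Fin n as its set of points.
record Space₁₂ (n : ℕ) : Set where
  field
    d        : DistanceFunction (Fin n)
    isMetric : IsMetric _≡_ d
    1or2     : ∀ x y → d x y ≢ 0 → d x y ≡ 1 ⊎ d x y ≡ 2

module _ {n : ℕ} (d : DistanceFunction (Fin n)) where

  Between : Fin n → Fin n → Fin n → Set
  Between a b c = (a ≢ b × b ≢ c × a ≢ c) × d a b ℕ.+ d b c ≡ d a c

  between? : ∀ a b c → Dec (Between a b c)
  between? a b c =
    (¬? (a ≟ b) ×-dec ¬? (b ≟ c) ×-dec ¬? (a ≟ c)) ×-dec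
    (d a b ℕ.+ d b c ℕ.≟ d a c)

  OnLine : Fin n → Fin n → Fin n → Set
  OnLine u v p =
    Between p u v ⊎ p ≡ u ⊎ Between u p v ⊎ p ≡ v ⊎ Between u v p

  onLine? : ∀ u v p → Dec (OnLine u v p)
  onLine? u v p =
    between? p u v ⊎-dec (p ≟ u) ⊎-dec between? u p v ⊎-dec (p ≟ v) ⊎-dec
    between? u v p

  line : Fin n → Fin n → Subset n
  line u v = tabulate (λ p → does (onLine? u v p))

distinctPairs : ∀ n → List (Fin n × Fin n)
distinctPairs n =
  filter (λ (u , v) → ¬? (u ≟ v)) (cartesianProduct (allFin n) (allFin n))

lines : ∀ {n} → DistanceFunction (Fin n) → List (Subset n)
lines {n} d = map (uncurry (line d)) (distinctPairs n)

numLines : ∀ {n} → Space₁₂ n → ℕ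
numLines S = length (deduplicate (≡-dec Bool._≟_) (lines (Space₁₂.d S)))

IsMinNumLines : ℕ → ℕ → Set
IsMinNumLines n k =
  (∃[ S ] numLines {n} S ≡ k) × (∀ (S : Space₁₂ n) → k ℕ.≤ numLines S)

-- The minimum exists: every 1-2 metric space is the space of a graph
-- (adjacent vertices at distance 1, non-adjacent ones at distance 2), and
-- the graphs on Fin n can be enumerated.
module _ {n : ℕ} (E : Fin n → Fin n → Bool) where

  private
    adjacency : Fin n → Fin n → ℕ
    adjacency x y = if E x y then (if E y x then 1 else 2) else 2

    adjacency-sym : ∀ x y → adjacency x y ≡ adjacency y x
    adjacency-sym x y with E x y | E y x
    ... | true  | true  = refl
    ... | true  | false = refl
    ... | false | true  = refl
    ... | false | false = refl

    adjacency-1or2 : ∀ x y → adjacency x y ≡ 1 ⊎ adjacency x y ≡ 2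
    adjacency-1or2 x y with E x y | E y x
    ... | true  | true  = inj₁ refl
    ... | true  | false = inj₂ refl
    ... | false | true  = inj₂ refl
    ... | false | false = inj₂ refl

    1≤adjacency : ∀ x y → 1 ℕ.≤ adjacency x y
    1≤adjacency x y with adjacency x y | adjacency-1or2 x y
    ... | .1 | inj₁ refl = ℕ.s≤s ℕ.z≤n
    ... | .2 | inj₂ refl = ℕ.s≤s ℕ.z≤n

    adjacency≤2 : ∀ x y → adjacency x y ℕ.≤ 2
    adjacency≤2 x y with adjacency x y | adjacency-1or2 x y
    ... | .1 | inj₁ refl = ℕ.s≤s ℕ.z≤n
    ... | .2 | inj₂ refl = ℕ.≤-refl

  graphDistance : DistanceFunction (Fin n)
  graphDistance x y with x ≟ y
  ... | yes _ = 0
  ... | no  _ = adjacency x y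

  private
    distance-refl : ∀ {x y} → x ≡ y → graphDistance x y ≡ 0
    distance-refl {x} {y} x≡y with x ≟ y
    ... | yes _  = refl
    ... | no x≢y = contradiction x≡y x≢y

    distance-definite : ∀ {x y} → graphDistance x y ≡ 0 → x ≡ y
    distance-definite {x} {y} eq with x ≟ y
    ... | yes x≡y = x≡y
    ... | no  _   with adjacency x y | 1≤adjacency x y
    distance-definite () | no _ | suc _ | _

    distance-sym : ∀ x y → graphDistance x y ≡ graphDistance y x
    distance-sym x y with x ≟ y | y ≟ x
    ... | yes _   | yes _   = refl
    ... | yes x≡y | no y≢x  = contradiction (sym x≡y) y≢x
    ... | no x≢y  | yes y≡x = contradiction (sym y≡x) x≢y
    ... | no _    | no _    = adjacency-sym x y

    triangle : ∀ x y z →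
      graphDistance x z ℕ.≤ graphDistance x y ℕ.+ graphDistance y z
    triangle x y z with x ≟ z | x ≟ y | y ≟ z
    ... | yes _  | _        | _        = ℕ.z≤n
    ... | no x≢z | yes refl | yes refl = contradiction refl x≢z
    ... | no _   | yes refl | no _     = ℕ.≤-refl
    ... | no _   | no _     | yes refl = ℕ.m≤m+n _ _
    ... | no _   | no _     | no _     = ℕ.≤-trans (adjacency≤2 x z)
      (ℕ.+-mono-≤ (1≤adjacency x y) (1≤adjacency y z))

  graphSpace : Space₁₂ n
  graphSpace = record
    { d        = graphDistance
    ; isMetric = record
      { isSemiMetric = record
        { isQuasiSemiMetric = record
          { isPreMetric = record
            { isProtoMetric = record
              { isPartialOrder  = ℕ.≤-isPartialOrder
              ; ≈-isEquivalence = isEquivalence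
              ; cong            = cong₂ graphDistance
              ; nonNegative     = ℕ.z≤n
              }
            ; ≈⇒0 = distance-refl
            }
          ; 0⇒≈ = distance-definite
          }
        ; sym = distance-sym
        }
      ; triangle = triangle
      }
    ; 1or2 = 1or2
    }
    where
    1or2 : ∀ x y → graphDistance x y ≢ 0 →
           graphDistance x y ≡ 1 ⊎ graphDistance x y ≡ 2
    1or2 x y d≢0 with x ≟ y
    ... | yes _ = contradiction refl d≢0
    ... | no _  = adjacency-1or2 x y

private
  does-cong : ∀ {A B : Set} → (A → B) → (B → A) →
              (a? : Dec A) (b? : Dec B) → does a? ≡ does b?
  does-cong f g (yes _) (yes _) = refl
  does-cong f g (yes a) (no ¬b) = contradiction (f a) ¬b
  does-cong f g (no ¬a) (yes b) = contradiction (g b) ¬a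
  does-cong f g (no _)  (no _)  = refl

lines-cong : ∀ {n} {d d′ : DistanceFunction (Fin n)} →
             (∀ x y → d x y ≡ d′ x y) → lines d ≡ lines d′
lines-cong {n} {d} {d′} d≗d′ = List.map-cong
  (λ (u , v) → tabulate-cong (λ p → does-cong (to d≗d′)
    (to (λ x y → sym (d≗d′ x y))) (onLine? d u v p) (onLine? d′ u v p)))
  (distinctPairs n)
  where
  betw : ∀ {d d′ : DistanceFunction (Fin n)} → (∀ x y → d x y ≡ d′ x y) →
         ∀ {a b c} → Between d a b c → Between d′ a b c
  betw e {a} {b} {c} (distinct , eq) = distinct ,
    trans (sym (cong₂ ℕ._+_ (e a b) (e b c))) (trans eq (e a c))

  to : ∀ {d d′ : DistanceFunction (Fin n)} → (∀ x y → d x y ≡ d′ x y) →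
       ∀ {u v p} → OnLine d u v p → OnLine d′ u v p
  to e (inj₁ b)                      = inj₁ (betw e b)
  to e (inj₂ (inj₁ b))               = inj₂ (inj₁ b)
  to e (inj₂ (inj₂ (inj₁ b)))        = inj₂ (inj₂ (inj₁ (betw e b)))
  to e (inj₂ (inj₂ (inj₂ (inj₁ b)))) = inj₂ (inj₂ (inj₂ (inj₁ b)))
  to e (inj₂ (inj₂ (inj₂ (inj₂ b)))) = inj₂ (inj₂ (inj₂ (inj₂ (betw e b))))

private
  bool : Fin 2 → Bool
  bool zero    = false
  bool (suc _) = true

  bit : Bool → Fin 2
  bit false = zero
  bit true  = suc zero

  bool-bit : ∀ b → bool (bit b) ≡ b
  bool-bit false = refl
  bool-bit true  = refl

  decode : ∀ {n} → Fin ((2 ℕ.^ n) ℕ.^ n) → Fin n → Fin n → Bool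
  decode c x y = bool (finToFun (finToFun c x) y)

  encode : ∀ {n} → (Fin n → Fin n → Bool) → Fin ((2 ℕ.^ n) ℕ.^ n)
  encode E = funToFin (λ x → funToFin (λ y → bit (E x y)))

  decode-encode : ∀ {n} (E : Fin n → Fin n → Bool) x y →
                  decode (encode E) x y ≡ E x y
  decode-encode E x y = trans
    (cong bool (trans
      (cong (λ c → finToFun c y)
        (finToFun-funToFin (λ x → funToFin (λ y → bit (E x y))) x))
      (finToFun-funToFin (λ y → bit (E x y)) y)))
    (bool-bit (E x y))

  module _ {n} (S : Space₁₂ n) where
    open Space₁₂ S
    open IsMetric isMetric using (≈⇒0; 0⇒≈) renaming (sym to d-sym)

    graphOf : Fin n → Fin n → Bool
    graphOf x y = does (d x y ℕ.≟ 1)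

    code : Fin ((2 ℕ.^ n) ℕ.^ n)
    code = encode graphOf

    code-distance : ∀ x y → graphDistance (decode code) x y ≡ d x y
    code-distance x y with x ≟ y
    ... | yes x≡y = sym (≈⇒0 x≡y)
    ... | no x≢y
      rewrite decode-encode graphOf x y | decode-encode graphOf y x | d-sym y x
      with d x y | 1or2 x y (λ eq → x≢y (0⇒≈ eq))
    ... | .1 | inj₁ refl = refl
    ... | .2 | inj₂ refl = refl

minNumLines : ∀ n → ∃[ k ] IsMinNumLines n k
minNumLines n = numLines best , (best , refl) , λ S → ℕ.≤-trans
  (All.lookup (f[argmin]≤f[xs] {f = numLines} default spaces)
    (∈-map⁺ (graphSpace ∘ decode) (∈-allFin (code S))))
  (ℕ.≤-reflexive (cong (length ∘ deduplicate (≡-dec Bool._≟_))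
    (lines-cong (code-distance S))))
  where
  default : Space₁₂ n
  default = graphSpace (λ _ _ → true)

  spaces : List (Space₁₂ n)
  spaces = map (graphSpace ∘ decode) (allFin ((2 ℕ.^ n) ℕ.^ n))

  best : Space₁₂ n
  best = argmin numLines default spaces

h : ℕ → ℕ
h n = proj₁ (minNumLines n)

record ℝ : Set where
  constructor mkℝ
  field
    seq    : ℕ → ℚᵘ
    cauchy : ∀ ε → 0ℚᵘ ℚ.< ε → ∃[ N ] ∀ m n → N ℕ.≤ m → N ℕ.≤ n →
             ℚ.∣ seq m ℚ.- seq n ∣ ℚ.≤ ε

open ℝ

infix  4 _≤_
infixl 6 _+_
infixl 7 _*_
infixr 8 _^_

fromℚ : ℚᵘ → ℝ
fromℚ q = mkℝ (λ _ → q) λ ε 0<ε → 0 , λ _ _ _ _ →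
  ℚ.≤-trans (ℚ.≤-reflexive (ℚ.∣-∣-cong (ℚ.+-inverseʳ q))) (ℚ.<⇒≤ 0<ε)

fromℕ : ℕ → ℝ
fromℕ n = fromℚ (+ n / 1)

-- Equality of reals is _≤_ in both directions.
_≤_ : ℝ → ℝ → Set
x ≤ y = ∀ ε → 0ℚᵘ ℚ.< ε →
        ∃[ N ] ∀ m → N ℕ.≤ m → seq x m ℚ.≤ seq y m ℚ.+ ε

private
  bounded : (x : ℝ) → ∃[ B ] 0ℚᵘ ℚ.< B ×
            ∃[ N ] ∀ m → N ℕ.≤ m → ℚ.∣ seq x m ∣ ℚ.≤ B
  bounded x with cauchy x 1ℚᵘ (ℚ.positive⁻¹ 1ℚᵘ)
  ... | N , close = B , 0<B , N , bound
    where
    B : ℚᵘ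
    B = 1ℚᵘ ℚ.+ ℚ.∣ seq x N ∣

    0<B : 0ℚᵘ ℚ.< B
    0<B = ℚ.<-≤-trans (ℚ.positive⁻¹ 1ℚᵘ)
      (ℚ.p≤p+q 1ℚᵘ ℚ.∣ seq x N ∣ {{ℚ.∣-∣-nonNeg (seq x N)}})

    bound : ∀ m → N ℕ.≤ m → ℚ.∣ seq x m ∣ ℚ.≤ B
    bound m N≤m = begin
      ℚ.∣ seq x m ∣
        ≃⟨ ℚ.∣-∣-cong (solve 2 (λ a b → a := (a :- b) :+ b) ℚ.≃-refl
             (seq x m) (seq x N)) ⟩
      ℚ.∣ (seq x m ℚ.- seq x N) ℚ.+ seq x N ∣
        ≤⟨ ℚ.∣p+q∣≤∣p∣+∣q∣ (seq x m ℚ.- seq x N) (seq x N) ⟩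
      ℚ.∣ seq x m ℚ.- seq x N ∣ ℚ.+ ℚ.∣ seq x N ∣
        ≤⟨ ℚ.+-monoˡ-≤ _ (close m N N≤m ℕ.≤-refl) ⟩
      B ∎
      where open ℚ.≤-Reasoning; open +-*-Solver

_+_ : ℝ → ℝ → ℝ
x + y = mkℝ (λ m → seq x m ℚ.+ seq y m) +-cauchy
  where
  +-cauchy : ∀ ε → 0ℚᵘ ℚ.< ε → ∃[ N ] ∀ m n → N ℕ.≤ m → N ℕ.≤ n →
    ℚ.∣ (seq x m ℚ.+ seq y m) ℚ.- (seq x n ℚ.+ seq y n) ∣ ℚ.≤ ε
  +-cauchy ε 0<ε = Nx ℕ.⊔ Ny , λ m n N≤m N≤n → begin
    ℚ.∣ (seq x m ℚ.+ seq y m) ℚ.- (seq x n ℚ.+ seq y n) ∣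
      ≃⟨ ℚ.∣-∣-cong (solve 4
           (λ a b c d → (a :+ b) :- (c :+ d) := (a :- c) :+ (b :- d))
           ℚ.≃-refl (seq x m) (seq y m) (seq x n) (seq y n)) ⟩
    ℚ.∣ (seq x m ℚ.- seq x n) ℚ.+ (seq y m ℚ.- seq y n) ∣
      ≤⟨ ℚ.∣p+q∣≤∣p∣+∣q∣ (seq x m ℚ.- seq x n) (seq y m ℚ.- seq y n) ⟩
    ℚ.∣ seq x m ℚ.- seq x n ∣ ℚ.+ ℚ.∣ seq y m ℚ.- seq y n ∣
      ≤⟨ ℚ.+-mono-≤
           (closeˣ m n (ℕ.m⊔n≤o⇒m≤o Nx Ny N≤m) (ℕ.m⊔n≤o⇒m≤o Nx Ny N≤n))
           (closeʸ m n (ℕ.m⊔n≤o⇒n≤o Nx Ny N≤m) (ℕ.m⊔n≤o⇒n≤o Nx Ny N≤n)) ⟩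
    ε/2 ℚ.+ ε/2
      ≃⟨ ℚ.*-distribʳ-+ ε ½ ½ ⟨
    (½ ℚ.+ ½) ℚ.* ε
      ≃⟨ ℚ.*-congʳ {ε} {½ ℚ.+ ½} {1ℚᵘ} (*≡* refl) ⟩
    1ℚᵘ ℚ.* ε
      ≃⟨ ℚ.*-identityˡ ε ⟩
    ε ∎
    where
    open ℚ.≤-Reasoning
    open +-*-Solver
    ε/2 : ℚᵘ
    ε/2 = ½ ℚ.* ε

    0<ε/2 : 0ℚᵘ ℚ.< ε/2
    0<ε/2 = ℚ.positive⁻¹ ε/2 {{ℚ.pos*pos⇒pos ½ ε {{ℚ.positive 0<ε}}}}

    Nx = proj₁ (cauchy x ε/2 0<ε/2)
    Ny = proj₁ (cauchy y ε/2 0<ε/2)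
    closeˣ = proj₂ (cauchy x ε/2 0<ε/2)
    closeʸ = proj₂ (cauchy y ε/2 0<ε/2)

_*_ : ℝ → ℝ → ℝ
x * y = mkℝ (λ m → seq x m ℚ.* seq y m) *-cauchy
  where
  *-cauchy : ∀ ε → 0ℚᵘ ℚ.< ε → ∃[ N ] ∀ m n → N ℕ.≤ m → N ℕ.≤ n →
    ℚ.∣ seq x m ℚ.* seq y m ℚ.- seq x n ℚ.* seq y n ∣ ℚ.≤ ε
  *-cauchy ε 0<ε with bounded x | bounded y
  ... | A , 0<A , Na , boundˣ | B , 0<B , Nb , boundʸ =
    (Na ℕ.⊔ Nb) ℕ.⊔ (Nx ℕ.⊔ Ny) , λ m n N≤m N≤n →
    let
      N₁≤m = ℕ.m⊔n≤o⇒m≤o (Na ℕ.⊔ Nb) (Nx ℕ.⊔ Ny) N≤m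
      N₁≤n = ℕ.m⊔n≤o⇒m≤o (Na ℕ.⊔ Nb) (Nx ℕ.⊔ Ny) N≤n
      N₂≤m = ℕ.m⊔n≤o⇒n≤o (Na ℕ.⊔ Nb) (Nx ℕ.⊔ Ny) N≤m
      N₂≤n = ℕ.m⊔n≤o⇒n≤o (Na ℕ.⊔ Nb) (Nx ℕ.⊔ Ny) N≤n
      x-bound = boundˣ m (ℕ.m⊔n≤o⇒m≤o Na Nb N₁≤m)
      y-bound = boundʸ n (ℕ.m⊔n≤o⇒n≤o Na Nb N₁≤n)
      x-close = closeˣ m n (ℕ.m⊔n≤o⇒m≤o Nx Ny N₂≤m) (ℕ.m⊔n≤o⇒m≤o Nx Ny N₂≤n)
      y-close = closeʸ m n (ℕ.m⊔n≤o⇒n≤o Nx Ny N₂≤m) (ℕ.m⊔n≤o⇒n≤o Nx Ny N₂≤n)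
    in begin
    ℚ.∣ seq x m ℚ.* seq y m ℚ.- seq x n ℚ.* seq y n ∣
      ≃⟨ ℚ.∣-∣-cong (solve 4
           (λ a b c d → a :* b :- c :* d := a :* (b :- d) :+ (a :- c) :* d)
           ℚ.≃-refl (seq x m) (seq y m) (seq x n) (seq y n)) ⟩
    ℚ.∣ seq x m ℚ.* (seq y m ℚ.- seq y n) ℚ.+
        (seq x m ℚ.- seq x n) ℚ.* seq y n ∣
      ≤⟨ ℚ.∣p+q∣≤∣p∣+∣q∣ (seq x m ℚ.* (seq y m ℚ.- seq y n)) _ ⟩
    ℚ.∣ seq x m ℚ.* (seq y m ℚ.- seq y n) ∣ ℚ.+
    ℚ.∣ (seq x m ℚ.- seq x n) ℚ.* seq y n ∣
      ≡⟨ cong₂ ℚ._+_ (ℚ.∣p*q∣≡∣p∣*∣q∣ (seq x m) _)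
                     (ℚ.∣p*q∣≡∣p∣*∣q∣ (seq x m ℚ.- seq x n) _) ⟩
    ℚ.∣ seq x m ∣ ℚ.* ℚ.∣ seq y m ℚ.- seq y n ∣ ℚ.+
    ℚ.∣ seq x m ℚ.- seq x n ∣ ℚ.* ℚ.∣ seq y n ∣
      ≤⟨ ℚ.+-mono-≤
           (ℚ.*-mono-≤-nonNeg {{ℚ.∣-∣-nonNeg (seq x m)}}
             {{ℚ.∣-∣-nonNeg (seq y m ℚ.- seq y n)}} x-bound y-close)
           (ℚ.*-mono-≤-nonNeg {{ℚ.∣-∣-nonNeg (seq x m ℚ.- seq x n)}}
             {{ℚ.∣-∣-nonNeg (seq y n)}} x-close y-bound) ⟩
    A ℚ.* η ℚ.+ η ℚ.* B
      ≃⟨ solve 4 (λ a b e i → a :* (e :* i) :+ (e :* i) :* b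
           := e :* (i :* (a :+ b))) ℚ.≃-refl A B ε (ℚ.1/ (A ℚ.+ B)) ⟩
    ε ℚ.* (ℚ.1/ (A ℚ.+ B) ℚ.* (A ℚ.+ B))
      ≃⟨ ℚ.*-congˡ {ε} (ℚ.*-inverseˡ (A ℚ.+ B)) ⟩
    ε ℚ.* 1ℚᵘ
      ≃⟨ ℚ.*-identityʳ ε ⟩
    ε ∎
    where
    open ℚ.≤-Reasoning
    open +-*-Solver
    instance
      A+B>0 : ℚ.Positive (A ℚ.+ B)
      A+B>0 = ℚ.pos+pos⇒pos A {{ℚ.positive 0<A}} B {{ℚ.positive 0<B}}

      A+B≢0 : ℚ.NonZero (A ℚ.+ B)
      A+B≢0 = ℚ.pos⇒nonZero (A ℚ.+ B)

    η : ℚᵘ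
    η = ε ℚ.* ℚ.1/ (A ℚ.+ B)

    0<η : 0ℚᵘ ℚ.< η
    0<η = ℚ.positive⁻¹ η {{ℚ.pos*pos⇒pos ε {{ℚ.positive 0<ε}}
      (ℚ.1/ (A ℚ.+ B)) {{ℚ.1/pos⇒pos (A ℚ.+ B)}}}}

    Nx = proj₁ (cauchy x η 0<η)
    Ny = proj₁ (cauchy y η 0<η)
    closeˣ = proj₂ (cauchy x η 0<η)
    closeʸ = proj₂ (cauchy y η 0<η)

largest : (P : ℕ → Bool) → ℕ → ℕ
largest P zero    = 0
largest P (suc b) = if P (suc b) then suc b else largest P b

private
  module _ (P : ℕ → Bool) where

    largest-holds : T (P 0) → ∀ b → T (P (largest P b))
    largest-holds P0 zero = P0
    largest-holds P0 (suc b) with P (suc b) in eq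
    ... | true  = subst T (sym eq) _
    ... | false = largest-holds P0 b

    largest-max : ∀ b {k} → k ℕ.≤ b → T (P k) → k ℕ.≤ largest P b
    largest-max zero    k≤b _ = k≤b
    largest-max (suc b) {k} k≤1+b Pk with P (suc b) in eq
    ... | true = k≤1+b
    ... | false with k ℕ.≟ suc b
    ...   | yes refl = contradiction (subst T eq Pk) λ ()
    ...   | no k≢1+b = largest-max b (ℕ.≤-pred (ℕ.≤∧≢⇒< k≤1+b k≢1+b)) Pk

fits : (e num den M k : ℕ) → Bool
fits e num den M k = k ℕ.^ e ℕ.* den ℕ.≤ᵇ num ℕ.* M ℕ.^ e

-- rootFloor e num den M is the largest k with (k / M) ^ e ≤ num / den.
rootFloor : (e num den M : ℕ) → ℕ
rootFloor e num den M = largest (fits e num den M) (num ℕ.* M ℕ.^ e)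

module _ (e num den : ℕ) .{{_ : NonZero e}} .{{_ : NonZero den}} where

  private
    m≤m^e : ∀ m e .{{_ : NonZero e}} → m ℕ.≤ m ℕ.^ e
    m≤m^e zero      _       = ℕ.z≤n
    m≤m^e m@(suc _) (suc e) = ℕ.m≤m*n m (m ℕ.^ e) {{ℕ.m^n≢0 m e}}

    ^-distribʳ-* : ∀ e a b → (a ℕ.* b) ℕ.^ e ≡ a ℕ.^ e ℕ.* b ℕ.^ e
    ^-distribʳ-* zero    a b = refl
    ^-distribʳ-* (suc e) a b = trans (cong (a ℕ.* b ℕ.*_) (^-distribʳ-* e a b))
      (interchange a b (a ℕ.^ e) (b ℕ.^ e))

    0^e≡0 : ∀ e .{{_ : NonZero e}} → 0 ℕ.^ e ≡ 0
    0^e≡0 (suc _) = refl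

  rootFloor-≤ : ∀ M → rootFloor e num den M ℕ.^ e ℕ.* den ℕ.≤ num ℕ.* M ℕ.^ e
  rootFloor-≤ M = ℕ.≤ᵇ⇒≤ _ _ (largest-holds (fits e num den M)
    (ℕ.≤⇒≤ᵇ (subst (λ z → z ℕ.* den ℕ.≤ num ℕ.* M ℕ.^ e) (sym (0^e≡0 e)) ℕ.z≤n))
    (num ℕ.* M ℕ.^ e))

  rootFloor-max : ∀ M k → k ℕ.^ e ℕ.* den ℕ.≤ num ℕ.* M ℕ.^ e →
                  k ℕ.≤ rootFloor e num den M
  rootFloor-max M k p = largest-max (fits e num den M) (num ℕ.* M ℕ.^ e)
    (ℕ.≤-trans (m≤m^e k e) (ℕ.≤-trans (ℕ.m≤m*n (k ℕ.^ e) den) p))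
    (ℕ.≤⇒≤ᵇ p)

  private
    floor : ℕ → ℕ
    floor m = rootFloor e num den (suc m)

    approx : ℕ → ℚᵘ
    approx m = + floor m / suc m

    cross : ∀ m l → floor m ℕ.* suc l ℕ.≤ suc (floor l) ℕ.* suc m
    cross m l with floor m ℕ.* suc l ℕ.≤? suc (floor l) ℕ.* suc m
    ... | yes p = p
    ... | no ¬p = contradiction (rootFloor-max L (suc k) too-large) ℕ.1+n≰n
      where
      open ℕ.≤-Reasoning
      L = suc l
      M = suc m
      k = floor l

      instance
        M^e≢0 : NonZero (M ℕ.^ e)
        M^e≢0 = ℕ.m^n≢0 M e

      swap : ∀ a b c → a ℕ.* b ℕ.* c ≡ a ℕ.* c ℕ.* b
      swap a b c = trans (ℕ.*-assoc a b c)
        (trans (cong (a ℕ.*_) (ℕ.*-comm b c)) (sym (ℕ.*-assoc a c b)))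

      too-large : suc k ℕ.^ e ℕ.* den ℕ.≤ num ℕ.* L ℕ.^ e
      too-large = ℕ.*-cancelʳ-≤ _ _ (M ℕ.^ e) (begin
        suc k ℕ.^ e ℕ.* den ℕ.* M ℕ.^ e
          ≡⟨ swap (suc k ℕ.^ e) den (M ℕ.^ e) ⟩
        suc k ℕ.^ e ℕ.* M ℕ.^ e ℕ.* den
          ≡⟨ cong (ℕ._* den) (^-distribʳ-* e (suc k) M) ⟨
        (suc k ℕ.* M) ℕ.^ e ℕ.* den
          ≤⟨ ℕ.*-monoˡ-≤ den (ℕ.^-monoˡ-≤ e (ℕ.≰⇒≥ ¬p)) ⟩
        (floor m ℕ.* L) ℕ.^ e ℕ.* den
          ≡⟨ cong (ℕ._* den) (^-distribʳ-* e (floor m) L) ⟩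
        floor m ℕ.^ e ℕ.* L ℕ.^ e ℕ.* den
          ≡⟨ swap (floor m ℕ.^ e) (L ℕ.^ e) den ⟩
        floor m ℕ.^ e ℕ.* den ℕ.* L ℕ.^ e
          ≤⟨ ℕ.*-monoˡ-≤ (L ℕ.^ e) (rootFloor-≤ M) ⟩
        num ℕ.* M ℕ.^ e ℕ.* L ℕ.^ e
          ≡⟨ swap num (M ℕ.^ e) (L ℕ.^ e) ⟩
        num ℕ.* L ℕ.^ e ℕ.* M ℕ.^ e ∎)

    approx-≤ : ∀ m l → approx m ℚ.- approx l ℚ.≤ + 1 / suc l
    approx-≤ m l = begin
      approx m ℚ.- approx l
        ≤⟨ ℚ.+-monoˡ-≤ (ℚ.- approx l) step ⟩
      (+ suc (floor l) / suc l) ℚ.- approx l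
        ≃⟨ ℚ.+-congˡ (ℚ.- approx l) split ⟩
      (+ 1 / suc l) ℚ.+ approx l ℚ.- approx l
        ≃⟨ solve 2 (λ a b → a :+ b :- b := a) ℚ.≃-refl (+ 1 / suc l) (approx l) ⟩
      + 1 / suc l ∎
      where
      open ℚ.≤-Reasoning
      open +-*-Solver
      step : approx m ℚ.≤ + suc (floor l) / suc l
      step = *≤* (subst₂ ℤ._≤_
        (ℤ.pos-* (floor m) (suc l)) (ℤ.pos-* (suc (floor l)) (suc m))
        (ℤ.+≤+ (cross m l)))

      split : (+ suc (floor l) / suc l) ℚ.≃ (+ 1 / suc l) ℚ.+ approx l
      split = *≡* (trans (sym (ℤ.*-assoc (+ suc (floor l)) (+ suc l) (+ suc l)))
        (cong (ℤ._* + suc l) (ℤ.*-distribʳ-+ (+ suc l) (+ 1) (+ floor l))))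

    1/-≤ : ∀ {ε} → 0ℚᵘ ℚ.< ε → ∀ m → ℚᵘ.denominator-1 ε ℕ.≤ m → + 1 / suc m ℚ.≤ ε
    1/-≤ {mkℚᵘ (+ suc a) d} 0<ε m d≤m = *≤* (subst₂ ℤ._≤_
      (ℤ.pos-* 1 (suc d)) (ℤ.pos-* (suc a) (suc m))
      (ℤ.+≤+ (ℕ.*-mono-≤ {1} {suc a} (ℕ.s≤s ℕ.z≤n) (ℕ.s≤s d≤m))))
    1/-≤ {mkℚᵘ (+ zero) d} (ℚ.*<* (ℤ.+<+ ())) _ _
    1/-≤ {mkℚᵘ -[1+ _ ] d} (ℚ.*<* ())         _ _

    approx-cauchy : ∀ ε → 0ℚᵘ ℚ.< ε → ∃[ N ] ∀ m n → N ℕ.≤ m → N ℕ.≤ n →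
                    ℚ.∣ approx m ℚ.- approx n ∣ ℚ.≤ ε
    approx-cauchy ε 0<ε = ℚᵘ.denominator-1 ε , close
      where
      close : ∀ m n → ℚᵘ.denominator-1 ε ℕ.≤ m → ℚᵘ.denominator-1 ε ℕ.≤ n →
              ℚ.∣ approx m ℚ.- approx n ∣ ℚ.≤ ε
      close m n N≤m N≤n with ℚ.∣p∣≡p∨∣p∣≡-p (approx m ℚ.- approx n)
      ... | inj₁ eq = subst (ℚ._≤ ε) (sym eq)
        (ℚ.≤-trans (approx-≤ m n) (1/-≤ 0<ε n N≤n))
      ... | inj₂ eq = subst (ℚ._≤ ε) (sym eq) (ℚ.≤-trans
        (ℚ.≤-reflexive (solve 2 (λ a b → :- (a :- b) := b :- a) ℚ.≃-refl
          (approx m) (approx n)))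
        (ℚ.≤-trans (approx-≤ n m) (1/-≤ 0<ε m N≤m)))
        where open +-*-Solver

  -- The e-th root of num / den, as the limit of its truncations to
  -- multiples of 1 / (m + 1).
  root : ℝ
  root = mkℝ approx approx-cauchy

-- n ^ (a / e) is the e-th root of n ^ a.
_^_ : (n : ℕ) .{{_ : NonZero n}} → ℚᵘ → ℝ
n ^ mkℚᵘ (+ a)    e-1 = root (suc e-1) (n ℕ.^ a) 1
n ^ mkℚᵘ -[1+ a ] e-1 = root (suc e-1) 1 (n ℕ.^ suc a) {{_}} {{ℕ.m^n≢0 n (suc a)}}

IsLittleO1 : (ℕ → ℝ) → Set
IsLittleO1 δ = ∀ ε → 0ℚᵘ ℚ.< ε →
  ∃[ N ] ∀ n → N ℕ.≤ n → fromℚ (ℚ.- ε) ≤ δ n × δ n ≤ fromℚ ε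

α β : ℝ
α = 2 ^ (ℤ.- (+ 7) / 3)
β = fromℕ 3 * 2 ^ (ℤ.- (+ 5) / 3)

{-# OPTIONS --safe #-}
module Submission where

-- Call two points adjacent at distance 1 and far at distance 2, and twins if
-- they are far and equidistant from every other point. Let N be the number of
-- lines.
--
-- Lower bound. If every two members of a k-element family are singled out by
-- some line, then k² ≤ 2 (k + N). A set of pairwise adjacent points is such a
-- family, and so, among points without twins, are the adjacent pairs with a
-- given line, and the far pairs with a given line. If half of the points have
-- twins, a far pair of such points is determined by its line unless its ends
-- are chosen partners, so there are at most about N far pairs, and by Turán's
-- bound some set of about n² / 8 N points is pairwise adjacent. Otherwise half
-- of the points have no twins, and as a line comes from at most about √(2 N)
-- of their pairs, n² / 8 is at most about N √(2 N). Both cases give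
-- n⁴ ≤ (1 + o(1)) 128 N³.
--
-- Upper bound. In a complete multipartite graph with parts of size s, a far
-- pair yields itself together with the complement of its part and an adjacent
-- pair yields the union of two parts, so there are about n s / 2 + n² / 2 s²
-- lines, which is least for s³ = 2 n.

open import Data.Bool.Base using (Bool; true; false; not)
import Data.Bool.Properties as Bool
open import Data.Fin.Base as Fin using (Fin; toℕ)
open import Data.Fin.Properties as Fin using (_≟_; toℕ-injective; toℕ<n)
open import Data.Fin.Subset using (Subset)
open import Data.List.Base
  using (List; []; _∷_; _++_; length; map; filter; cartesianProduct; deduplicate; allFin; upTo)
open import Data.List.Membership.Propositional using (_∈_; lose)
open import Data.List.Membership.Propositional.Properties
  using ( ∈-filter⁺; ∈-filter⁻; ∈-cartesianProduct⁺; ∈-cartesianProduct⁻; ∈-++⁺ˡ; ∈-++⁺ʳ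
        ; ∈-map⁺; ∈-map⁻; ∈-allFin; ∈-upTo⁺; ∈-deduplicate⁺; ∈-deduplicate⁻)
open import Data.List.Properties
  using (length-map; length-++; length-tabulate; length-upTo; filter-++)
open import Data.List.Relation.Unary.All as All using (All; []; _∷_)
open import Data.List.Relation.Unary.AllPairs as AllPairs using (AllPairs; []; _∷_)
open import Data.List.Relation.Unary.Any using (Any; here; there; any?)
open import Data.List.Relation.Unary.Unique.DecPropositional.Properties using (deduplicate-!)
open import Data.List.Relation.Unary.Unique.Propositional using (Unique)
import Data.List.Relation.Unary.Unique.Propositional.Properties as Unique
open import Data.Nat.Base as ℕ using (ℕ; NonZero; zero; suc; s≤s; z≤n)
open import Data.Nat.ListAction using (sum)
import Data.Nat.Properties as ℕ
open import Data.Nat.Tactic.RingSolver using (solve-∀)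
open import Data.Product.Base using (_×_; ∃-syntax; _,_; proj₁; proj₂; uncurry; swap)
import Data.Product.Properties as Product
open import Data.Sum.Base using (_⊎_; inj₁; inj₂)
open import Data.Sum.Properties as Sum using (inj₁-injective; inj₂-injective)
open import Data.Vec.Base using (lookup; tabulate)
open import Data.Vec.Properties using (≡-dec; lookup∘tabulate; tabulate-cong)
open import Defs hiding (_≤_; _+_; _*_; _^_)
open import Function.Base using (_∘_; const; id)
open import Function.Bundles using (mk⇔)
open import Function.Metric.Nat.Structures using (IsMetric)
open import Level using (0ℓ)
open import Relation.Binary.Core using (Rel)
open import Relation.Binary.Definitions
  using (Decidable; DecidableEquality; Reflexive; Symmetric; tri<; tri≈; tri>)
open import Relation.Binary.PropositionalEquality
  using (_≡_; _≢_; refl; sym; trans; cong; cong₂; subst; subst₂; ≢-sym)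
open import Relation.Nullary.Decidable
  using (Dec; yes; no; ¬?; does; dec-true; dec-false; does-⇔; _×-dec_; _⊎-dec_; _→-dec_)
open import Relation.Nullary.Negation using (¬_; contradiction)
import Relation.Unary as Unary

-- Twins cut both ways, which is why the points are split by them. If `v` and `x` are twins adjacent
-- to `u`, the pairs `u`, `v` and `u`, `x` have the same line, so in the presence of twins a line
-- may come from very many adjacent pairs; the multipartite graphs exploit exactly this. Without
-- twins, adjacent pairs with a common line are disjoint, and any two of them span an induced
-- four-cycle, a pattern rigid enough for the family bound. For far pairs the effect is reversed: a
-- twin of one end makes a collision of lines impossible. The family bound is used twice over, once
-- for cliques and once for the pairs behind one line, and both uses give the same threshold of
-- about √(2 N); this is why the two cases end with the same constant, and the cube root of 128 is
-- 1/α. In the construction, s³ = 2 n turns the estimate into 3 n s / 4, which is β n^(4/3). All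
-- estimates compare cubes of natural numbers. Roots enter only at the end, as truncations, and the
-- two o(1) terms are explicit rational functions of an integer cube root.

-- Counting by fibres and labels, and Turán's bound.

module Counting where

  open import Data.Nat.Base
  open import Data.Nat.Properties hiding (_≟_)

  length-filter-¬ : ∀ {A : Set} {P : Unary.Pred A 0ℓ} (P? : Unary.Decidable P) xs →
                    length xs ≡ length (filter P? xs) + length (filter (¬? ∘ P?) xs)
  length-filter-¬ P? [] = refl
  length-filter-¬ P? (x ∷ xs) with P? x
  ... | yes _ = cong suc (length-filter-¬ P? xs)
  ... | no _  = trans (cong suc (length-filter-¬ P? xs)) (sym (+-suc _ _))

  module _ {A B : Set} (_≟_ : DecidableEquality B) (f : A → B) where

    fibre : List A → B → List A
    fibre xs y = filter (λ a → f a ≟ y) xs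

    length≤fibres : ∀ k xs ys → (∀ {a} → a ∈ xs → f a ∈ ys) →
                    (∀ {y} → y ∈ ys → length (fibre xs y) ≤ k) →
                    length xs ≤ k * length ys
    length≤fibres k []       []       cover bound = z≤n
    length≤fibres k (x ∷ xs) []       cover bound with () ← cover (here refl)
    length≤fibres k xs       (y ∷ ys) cover bound = begin
      length xs
        ≡⟨ length-filter-¬ (λ a → f a ≟ y) xs ⟩
      length (fibre xs y) + length rest
        ≤⟨ +-mono-≤ (bound (here refl)) (length≤fibres k rest ys cover′ bound′) ⟩
      k + k * length ys
        ≡⟨ *-suc k (length ys) ⟨
      k * suc (length ys) ∎
      where
      open ≤-Reasoning
      rest : List A
      rest = filter (λ a → ¬? (f a ≟ y)) xs

      cover′ : ∀ {a} → a ∈ rest → f a ∈ ys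
      cover′ a∈rest with ∈-filter⁻ (λ a → ¬? (f a ≟ y)) {xs = xs} a∈rest
      ... | a∈xs , fa≢y with cover a∈xs
      ... | here fa≡y = contradiction fa≡y fa≢y
      ... | there p   = p

      filter-filter : ∀ {P Q : Unary.Pred A 0ℓ} (P? : Unary.Decidable P) (Q? : Unary.Decidable Q) zs →
                      length (filter P? (filter Q? zs)) ≤ length (filter P? zs)
      filter-filter P? Q? [] = z≤n
      filter-filter P? Q? (z ∷ zs) with Q? z | P? z in eq
      ... | yes _ | p rewrite eq with p
      ...   | yes _ = s≤s (filter-filter P? Q? zs)
      ...   | no _  = filter-filter P? Q? zs
      filter-filter P? Q? (z ∷ zs) | no _ | yes _ = m≤n⇒m≤1+n (filter-filter P? Q? zs)
      filter-filter P? Q? (z ∷ zs) | no _ | no _  = filter-filter P? Q? zs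

      bound′ : ∀ {z} → z ∈ ys → length (fibre rest z) ≤ k
      bound′ {z} z∈ys = ≤-trans
        (filter-filter (λ a → f a ≟ z) (λ a → ¬? (f a ≟ y)) xs)
        (bound (there z∈ys))

  Unique⇒length≤1 : ∀ {A : Set} {a : A} {xs} → Unique xs →
                    (∀ {b} → b ∈ xs → b ≡ a) → length xs ≤ 1
  Unique⇒length≤1 {xs = []}         _                 _   = z≤n
  Unique⇒length≤1 {xs = x ∷ []}     _                 _   = s≤s z≤n
  Unique⇒length≤1 {xs = x ∷ y ∷ _} ((x≢y ∷ _) ∷ _) all =
    contradiction (trans (all (here refl)) (sym (all (there (here refl))))) x≢y

  Unique⇒length≤2 : ∀ {A : Set} {a a′ : A} {xs} → Unique xs →
                    (∀ {b} → b ∈ xs → b ≡ a ⊎ b ≡ a′) → length xs ≤ 2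
  Unique⇒length≤2 {xs = []} _ _ = z≤n
  Unique⇒length≤2 {a = a} {a′} {xs = x ∷ xs} (x∉xs ∷ uxs) all with all (here refl)
  ... | inj₁ refl = s≤s (Unique⇒length≤1 {a = a′} uxs other)
    where
    other : ∀ {b} → b ∈ xs → b ≡ a′
    other b∈ with all (there b∈)
    ... | inj₁ refl = contradiction refl (All.lookup x∉xs b∈)
    ... | inj₂ eq   = eq
  ... | inj₂ refl = s≤s (Unique⇒length≤1 {a = a} uxs other)
    where
    other : ∀ {b} → b ∈ xs → b ≡ a
    other b∈ with all (there b∈)
    ... | inj₂ refl = contradiction refl (All.lookup x∉xs b∈)
    ... | inj₁ eq   = eq

  injective⇒length≤ : ∀ {A B : Set} (_≟_ : DecidableEquality B) (f : A → B) {xs ys} → Unique xs →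
    (∀ {a} → a ∈ xs → f a ∈ ys) →
    (∀ {a b} → a ∈ xs → b ∈ xs → f a ≡ f b → b ≡ a) →
    length xs ≤ length ys
  injective⇒length≤ {A} _≟_ f {xs} {ys} uxs cover inj =
    subst (length xs ≤_) (*-identityˡ _) (length≤fibres _≟_ f 1 xs ys cover bound)
    where
    bound : ∀ {y} → y ∈ ys → length (fibre _≟_ f xs y) ≤ 1
    bound {y} _ with fibre _≟_ f xs y in eq
    ... | []     = z≤n
    ... | a ∷ as = Unique⇒length≤1 (subst Unique eq (Unique.filter⁺ (λ a → f a ≟ y) uxs)) same
      where
      member : ∀ {b} → b ∈ a ∷ as → b ∈ xs × f b ≡ y
      member b∈ = ∈-filter⁻ (λ a → f a ≟ y) (subst (_ ∈_) (sym eq) b∈)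

      same : ∀ {b} → b ∈ a ∷ as → b ≡ a
      same b∈ with member (here refl) | member b∈
      ... | a∈xs , fa≡y | b∈xs , fb≡y = inj a∈xs b∈xs (trans fa≡y (sym fb≡y))

  -- The mate `a′` need not belong to `xs`, so the reversal of a pair can serve as its mate without
  -- a check that it occurs.
  twoToOne⇒length≤ : ∀ {A B : Set} (_≟_ : DecidableEquality B) (f : A → B) {xs ys} → Unique xs →
    (∀ {a} → a ∈ xs → f a ∈ ys) →
    (∀ {a} → a ∈ xs → ∃[ a′ ] ∀ {b} → b ∈ xs → f a ≡ f b → b ≡ a ⊎ b ≡ a′) →
    length xs ≤ 2 * length ys
  twoToOne⇒length≤ {A} _≟_ f {xs} {ys} uxs cover mate =
    length≤fibres _≟_ f 2 xs ys cover bound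
    where
    bound : ∀ {y} → y ∈ ys → length (fibre _≟_ f xs y) ≤ 2
    bound {y} _ with fibre _≟_ f xs y in eq
    ... | []     = z≤n
    ... | a ∷ as = Unique⇒length≤2 (subst Unique eq (Unique.filter⁺ (λ a → f a ≟ y) uxs)) same
      where
      member : ∀ {b} → b ∈ a ∷ as → b ∈ xs × f b ≡ y
      member b∈ = ∈-filter⁻ (λ a → f a ≟ y) (subst (_ ∈_) (sym eq) b∈)

      a∈xs : a ∈ xs
      a∈xs = proj₁ (member (here refl))

      same : ∀ {b} → b ∈ a ∷ as → b ≡ a ⊎ b ≡ proj₁ (mate a∈xs)
      same b∈ = proj₂ (mate a∈xs) (proj₁ (member b∈))
        (trans (proj₂ (member (here refl))) (sym (proj₂ (member b∈))))

  length-cartesianProduct : ∀ {A B : Set} (xs : List A) (ys : List B) →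
                            length (cartesianProduct xs ys) ≡ length xs * length ys
  length-cartesianProduct []       ys = refl
  length-cartesianProduct (x ∷ xs) ys = trans (length-++ (map (x ,_) ys))
    (cong₂ _+_ (length-map (x ,_) ys) (length-cartesianProduct xs ys))

  length-map-++-map : ∀ {A B : Set} (xs : List A) (ys : List B) →
    length (map inj₁ xs ++ map inj₂ ys) ≡ length xs + length ys
  length-map-++-map xs ys = trans (length-++ (map inj₁ xs))
    (cong₂ _+_ (length-map inj₁ xs) (length-map inj₂ ys))

  module _ {A : Set} where

    ∑ : List A → (A → ℕ) → ℕ
    ∑ xs f = sum (map f xs)

    ∑-mono : ∀ xs {f g : A → ℕ} → (∀ {x} → x ∈ xs → f x ≤ g x) → ∑ xs f ≤ ∑ xs g
    ∑-mono []       f≤g = z≤n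
    ∑-mono (x ∷ xs) f≤g = +-mono-≤ (f≤g (here refl)) (∑-mono xs (f≤g ∘ there))

    ∑-cong : ∀ xs {f g : A → ℕ} → (∀ x → f x ≡ g x) → ∑ xs f ≡ ∑ xs g
    ∑-cong []       f≡g = refl
    ∑-cong (x ∷ xs) f≡g = cong₂ _+_ (f≡g x) (∑-cong xs f≡g)

    ∑-1 : ∀ xs → ∑ xs (const 1) ≡ length xs
    ∑-1 []       = refl
    ∑-1 (x ∷ xs) = cong suc (∑-1 xs)

    ∑-+ : ∀ xs (f g : A → ℕ) → ∑ xs (λ x → f x + g x) ≡ ∑ xs f + ∑ xs g
    ∑-+ []       f g = refl
    ∑-+ (x ∷ xs) f g = trans (cong (f x + g x +_) (∑-+ xs f g)) (interchange (f x) (g x) _ _)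
      where
      interchange : ∀ a b c d → a + b + (c + d) ≡ a + c + (b + d)
      interchange = solve-∀

    ∑-0 : ∀ xs → ∑ xs (const 0) ≡ 0
    ∑-0 []       = refl
    ∑-0 (x ∷ xs) = ∑-0 xs

    ∑-swap : ∀ xs ys (r : A → A → ℕ) →
             ∑ xs (λ x → ∑ ys (r x)) ≡ ∑ ys (λ y → ∑ xs (λ x → r x y))
    ∑-swap []       ys r = sym (∑-0 ys)
    ∑-swap (x ∷ xs) ys r = trans (cong (∑ ys (r x) +_) (∑-swap xs ys r))
      (sym (∑-+ ys (r x) (λ y → ∑ xs (λ x → r x y))))

  module _ {A : Set} {R : Rel A 0ℓ} (R? : Decidable R)
           (R-refl : Reflexive R) (R-sym : Symmetric R) where

    private
      indicator : A → A → ℕ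
      indicator x y with R? x y
      ... | yes _ = 1
      ... | no  _ = 0

      indicator-1 : ∀ {x y} → R x y → indicator x y ≡ 1
      indicator-1 {x} {y} r with R? x y
      ... | yes _ = refl
      ... | no ¬r = contradiction r ¬r

      indicator-sym : ∀ x y → indicator x y ≡ indicator y x
      indicator-sym x y with R? x y | R? y x
      ... | yes _ | yes _ = refl
      ... | yes r | no ¬r = contradiction (R-sym r) ¬r
      ... | no ¬r | yes r = contradiction (R-sym r) ¬r
      ... | no _  | no _  = refl

      count : List A → List A → ℕ
      count xs ys = ∑ xs (λ x → ∑ ys (indicator x))

      row : ∀ x ys → length (filter (λ (x , y) → R? x y) (map (x ,_) ys)) ≡ ∑ ys (indicator x)
      row x []       = refl
      row x (y ∷ ys) with R? x y
      ... | yes _ = cong suc (row x ys)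
      ... | no  _ = row x ys

      count-pairs : ∀ xs ys →
        length (filter (λ (x , y) → R? x y) (cartesianProduct xs ys)) ≡ count xs ys
      count-pairs []       ys = refl
      count-pairs (x ∷ xs) ys = trans
        (cong length (filter-++ (λ (x , y) → R? x y) (map (x ,_) ys) (cartesianProduct xs ys)))
        (trans (length-++ (filter (λ (x , y) → R? x y) (map (x ,_) ys)))
          (cong₂ _+_ (row x ys) (count-pairs xs ys)))

      -- `∑-split` replaces a permutation between `xs` and the two lists: double sums over `xs` and,
      -- with the constant 1, its length are all that `turán` has to split.
      record Splitting (xs : List A) : Set where
        field
          independent dominated : List A
          unrelated : AllPairs (λ x y → ¬ R x y) independent
          dominates : All (λ y → Any (R y) independent) dominated
          ∑-split   : ∀ f → ∑ xs f ≡ ∑ independent f + ∑ dominated f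

      -- Greedy choice from the end of the list: an element unrelated to everything chosen so far is
      -- chosen too. The chosen list only grows, so what is dominated stays dominated.
      split : ∀ xs → Splitting xs
      split [] = record
        { independent = [] ; dominated = [] ; unrelated = [] ; dominates = []
        ; ∑-split = λ _ → refl }
      split (x ∷ xs) with split xs
      ... | record { independent = I ; dominated = J ; unrelated = unr ; dominates = dom ; ∑-split = eq }
        with any? (R? x) I
      ... | yes r = record
        { independent = I ; dominated = x ∷ J ; unrelated = unr ; dominates = r ∷ dom
        ; ∑-split = λ f → trans (cong (f x +_) (eq f)) (exchange (f x) (∑ I f) (∑ J f)) }
        where
        exchange : ∀ a b c → a + (b + c) ≡ b + (a + c)
        exchange = solve-∀
      ... | no ¬r = record
        { independent = x ∷ I ; dominated = J
        ; unrelated = All.tabulate (λ y∈I r → ¬r (lose y∈I r)) ∷ unr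
        ; dominates = All.map there dom
        ; ∑-split = λ f → trans (cong (f x +_) (eq f)) (sym (+-assoc (f x) _ _)) }
      1≤∑ : ∀ {y zs} → Any (R y) zs → 1 ≤ ∑ zs (indicator y)
      1≤∑ {zs = z ∷ zs} (here r)  = ≤-trans (≤-reflexive (sym (indicator-1 r))) (m≤m+n _ _)
      1≤∑ {zs = z ∷ zs} (there p) = ≤-trans (1≤∑ p) (m≤n+m _ _)

      length≤count : ∀ xs {zs} → (∀ {x} → x ∈ xs → Any (R x) zs) → length xs ≤ count xs zs
      length≤count xs {zs} dom =
        subst (_≤ count xs zs) (∑-1 xs) (∑-mono xs (λ x∈ → 1≤∑ (dom x∈)))

    -- Removing a maximal set I of unrelated elements from xs leaves a list J
    -- each of whose members is related to a member of I, so the number of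
    -- related pairs drops by at least |I| + 2 |J|, while |I| ≤ m.
    turán : ∀ m → (∀ zs → AllPairs (λ x y → ¬ R x y) zs → length zs ≤ m) → ∀ xs →
            length xs * length xs ≤
            m * length (filter (λ (x , y) → R? x y) (cartesianProduct xs xs))
    turán m small xs = subst (λ c → length xs * length xs ≤ m * c)
      (sym (count-pairs xs xs)) (bounded (length xs) xs ≤-refl)
      where
      bounded : ∀ k xs → length xs ≤ k → length xs * length xs ≤ m * count xs xs
      bounded k       []           _     = z≤n
      bounded (suc k) xs@(x ∷ xs′) N≤1+k = begin
        length xs * length xs
          ≡⟨ cong (λ l → l * l) N≡ ⟩
        (a + b) * (a + b)
          ≡⟨ square a b ⟩
        a * (a + 2 * b) + b * b
          ≤⟨ +-mono-≤ (*-monoˡ-≤ (a + 2 * b) (small I unrelated)) (bounded k J b≤k) ⟩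
        m * (a + 2 * b) + m * count J J
          ≡⟨ *-distribˡ-+ m (a + 2 * b) (count J J) ⟨
        m * (a + 2 * b + count J J)
          -- Reflexivity gives each member of `I` a pair within `I`, and domination gives each
          -- member of `J` a pair with `I`, which symmetry counts in both orders.
          ≤⟨ *-monoʳ-≤ m (+-monoˡ-≤ (count J J) (+-mono-≤
               (length≤count I (λ x∈I → lose x∈I R-refl))
               (*-monoʳ-≤ 2 (length≤count J (All.lookup dominates))))) ⟩
        m * (count I I + 2 * count J I + count J J)
          ≡⟨ cong (m *_) total ⟨
        m * count xs xs ∎
        where
        open ≤-Reasoning
        open Splitting (split xs) renaming (independent to I; dominated to J)
        a b : ℕ
        a = length I
        b = length J

        N≡ : length xs ≡ a + b
        N≡ = trans (sym (∑-1 xs)) (trans (∑-split (const 1)) (cong₂ _+_ (∑-1 I) (∑-1 J)))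

        -- With `I` empty nothing could be dominated, so `J` would be empty as well. Hence `J` is
        -- strictly shorter than `xs` and the induction on length descends.
        1≤a : 1 ≤ a
        1≤a with I | J | N≡ | dominates
        ... | _ ∷ _ | _      | _  | _       = s≤s z≤n
        ... | []    | _ ∷ _  | _  | () ∷ _

        b≤k : b ≤ k
        b≤k = ≤-pred (≤-trans (+-monoˡ-≤ b 1≤a) (≤-trans (≤-reflexive (sym N≡)) N≤1+k))

        square : ∀ a b → (a + b) * (a + b) ≡ a * (a + 2 * b) + b * b
        square = solve-∀

        total : count xs xs ≡ count I I + 2 * count J I + count J J
        total = begin-equality
          count xs xs
            ≡⟨ ∑-split _ ⟩
          count I xs + count J xs
            ≡⟨ cong₂ _+_ (split² I) (split² J) ⟩
          (count I I + count I J) + (count J I + count J J)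
            ≡⟨ cong (λ c → (count I I + c) + (count J I + count J J)) flip ⟩
          (count I I + count J I) + (count J I + count J J)
            ≡⟨ collect (count I I) (count J I) (count J J) ⟩
          count I I + 2 * count J I + count J J ∎
          where
          split² : ∀ zs → count zs xs ≡ count zs I + count zs J
          split² zs = trans (∑-cong zs (λ z → ∑-split (indicator z)))
            (∑-+ zs (λ z → ∑ I (indicator z)) (λ z → ∑ J (indicator z)))

          flip : count I J ≡ count J I
          flip = trans (∑-swap I J indicator)
            (∑-cong J (λ y → ∑-cong I (λ x → indicator-sym x y)))

          collect : ∀ p q r → (p + q) + (q + r) ≡ p + 2 * q + r
          collect = solve-∀

-- Lower bound

module Lines where

  open import Data.Nat.Base
  open import Data.Nat.Properties hiding (_≟_)
  open Counting

  AllPairs-lookup : ∀ {A : Set} {Q : Rel A 0ℓ} → Symmetric Q → ∀ {xs x y} →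
                    AllPairs Q xs → x ∈ xs → y ∈ xs → x ≢ y → Q x y
  AllPairs-lookup Q-sym (Qx ∷ _) (here refl) (here refl) x≢y = contradiction refl x≢y
  AllPairs-lookup Q-sym (Qx ∷ _) (here refl) (there y∈)  _   = All.lookup Qx y∈
  AllPairs-lookup Q-sym (Qy ∷ _) (there x∈)  (here refl) _   = Q-sym (All.lookup Qy x∈)
  AllPairs-lookup Q-sym (_ ∷ Qs) (there x∈)  (there y∈)  x≢y = AllPairs-lookup Q-sym Qs x∈ y∈ x≢y

  does-true : ∀ {A : Set} (a? : Dec A) → does a? ≡ true → A
  does-true (yes a) _ = a

  _≟ᴸ_ : ∀ {n} → DecidableEquality (Subset n)
  _≟ᴸ_ = ≡-dec Bool._≟_

  -- Points on a line, pairs with equal lines, and the family bound.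

  module _ {n : ℕ} (S : Space₁₂ n) where
    open Space₁₂ S
    open IsMetric isMetric using (≈⇒0; 0⇒≈) renaming (sym to d-sym)

    private
      variable
        p q u v w x : Fin n

    Adj Far : Fin n → Fin n → Set
    Adj u v = d u v ≡ 1
    Far u v = d u v ≡ 2

    adj-sym : Adj u v → Adj v u
    adj-sym = trans (d-sym _ _)

    far-sym : Far u v → Far v u
    far-sym = trans (d-sym _ _)

    adj⇒¬far : Adj u v → ¬ Far u v
    adj⇒¬far a f with () ← trans (sym a) f

    adj⇒≢ : Adj u v → u ≢ v
    adj⇒≢ a u≡v with () ← trans (sym a) (≈⇒0 u≡v)

    far⇒≢ : Far u v → u ≢ v
    far⇒≢ f u≡v with () ← trans (sym f) (≈⇒0 u≡v)

    adj⊎far : u ≢ v → Adj u v ⊎ Far u v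
    adj⊎far u≢v = 1or2 _ _ (u≢v ∘ 0⇒≈)

    ¬adj⇒far : u ≢ v → ¬ Adj u v → Far u v
    ¬adj⇒far u≢v ¬a with adj⊎far u≢v
    ... | inj₁ a = contradiction a ¬a
    ... | inj₂ f = f

    between⁺ : Adj u v → Adj v w → Far u w → Between d u v w
    between⁺ a b f = (adj⇒≢ a , adj⇒≢ b , far⇒≢ f) , trans (cong₂ _+_ a b) (sym f)

    -- Of the eight patterns of distances only 1 + 1 = 2 adds up.
    between⁻ : Between d u v w → Adj u v × Adj v w × Far u w
    between⁻ ((u≢v , v≢w , u≢w) , eq) with adj⊎far u≢v | adj⊎far v≢w | adj⊎far u≢w
    ... | inj₁ a | inj₁ b | inj₂ f = a , b , f
    ... | inj₁ a | inj₁ b | inj₁ c with () ← trans (sym (cong₂ _+_ a b)) (trans eq c)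
    ... | inj₁ a | inj₂ b | inj₁ c with () ← trans (sym (cong₂ _+_ a b)) (trans eq c)
    ... | inj₁ a | inj₂ b | inj₂ c with () ← trans (sym (cong₂ _+_ a b)) (trans eq c)
    ... | inj₂ a | inj₁ b | inj₁ c with () ← trans (sym (cong₂ _+_ a b)) (trans eq c)
    ... | inj₂ a | inj₁ b | inj₂ c with () ← trans (sym (cong₂ _+_ a b)) (trans eq c)
    ... | inj₂ a | inj₂ b | inj₁ c with () ← trans (sym (cong₂ _+_ a b)) (trans eq c)
    ... | inj₂ a | inj₂ b | inj₂ c with () ← trans (sym (cong₂ _+_ a b)) (trans eq c)

    left-on : OnLine d u v u
    left-on = inj₂ (inj₁ refl)

    right-on : OnLine d u v v
    right-on = inj₂ (inj₂ (inj₂ (inj₁ refl)))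

    far-on⁺ : Far u v → Adj p u → Adj p v → OnLine d u v p
    far-on⁺ f a b = inj₂ (inj₂ (inj₁ (between⁺ (adj-sym a) b f)))

    -- Only the middle position survives: in the two outer ones `u` and `v` would be at distance 1.
    far-on⁻ : Far u v → OnLine d u v p → p ≡ u ⊎ p ≡ v ⊎ (Adj p u × Adj p v)
    far-on⁻ f (inj₁ b) = contradiction f (adj⇒¬far (proj₁ (proj₂ (between⁻ b))))
    far-on⁻ f (inj₂ (inj₁ p≡u)) = inj₁ p≡u
    far-on⁻ f (inj₂ (inj₂ (inj₁ b))) with between⁻ b
    ... | a , a′ , _ = inj₂ (inj₂ (adj-sym a , a′))
    far-on⁻ f (inj₂ (inj₂ (inj₂ (inj₁ p≡v)))) = inj₂ (inj₁ p≡v)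
    far-on⁻ f (inj₂ (inj₂ (inj₂ (inj₂ b)))) = contradiction f (adj⇒¬far (proj₁ (between⁻ b)))

    Separates : Fin n → Fin n → Fin n → Set
    Separates p u v = (Adj p u × Far p v) ⊎ (Far p u × Adj p v)

    adj-on⁺ : Adj u v → Separates p u v → OnLine d u v p
    adj-on⁺ a (inj₁ (b , f)) = inj₁ (between⁺ b a f)
    adj-on⁺ a (inj₂ (f , b)) = inj₂ (inj₂ (inj₂ (inj₂ (between⁺ a (adj-sym b) (far-sym f)))))

    adj-on⁻ : Adj u v → OnLine d u v p → p ≡ u ⊎ p ≡ v ⊎ Separates p u v
    adj-on⁻ a (inj₁ b) with between⁻ b
    ... | b′ , _ , f = inj₂ (inj₂ (inj₁ (b′ , f)))
    adj-on⁻ a (inj₂ (inj₁ p≡u)) = inj₁ p≡u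
    adj-on⁻ a (inj₂ (inj₂ (inj₁ b))) = contradiction (proj₂ (proj₂ (between⁻ b))) (adj⇒¬far a)
    adj-on⁻ a (inj₂ (inj₂ (inj₂ (inj₁ p≡v)))) = inj₂ (inj₁ p≡v)
    adj-on⁻ a (inj₂ (inj₂ (inj₂ (inj₂ b)))) with between⁻ b
    ... | _ , b′ , f = inj₂ (inj₂ (inj₂ (far-sym f , adj-sym b′)))

    onLine-swap : OnLine d u v p → OnLine d v u p
    onLine-swap (inj₁ b) with between⁻ b
    ... | a , a′ , f = inj₂ (inj₂ (inj₂ (inj₂ (between⁺ (adj-sym a′) (adj-sym a) (far-sym f)))))
    onLine-swap (inj₂ (inj₁ p≡u)) = inj₂ (inj₂ (inj₂ (inj₁ p≡u)))
    onLine-swap (inj₂ (inj₂ (inj₁ b))) with between⁻ b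
    ... | a , a′ , f = inj₂ (inj₂ (inj₁ (between⁺ (adj-sym a′) (adj-sym a) (far-sym f))))
    onLine-swap (inj₂ (inj₂ (inj₂ (inj₁ p≡v)))) = inj₂ (inj₁ p≡v)
    onLine-swap (inj₂ (inj₂ (inj₂ (inj₂ b)))) with between⁻ b
    ... | a , a′ , f = inj₁ (between⁺ (adj-sym a′) (adj-sym a) (far-sym f))

    _∋_ : Subset n → Fin n → Set
    L ∋ p = lookup L p ≡ true

    ∋⁺ : OnLine d u v p → line d u v ∋ p
    ∋⁺ {u} {v} {p} o = trans (lookup∘tabulate _ p) (dec-true (onLine? d u v p) o)

    ∋⁻ : line d u v ∋ p → OnLine d u v p
    ∋⁻ {u} {v} {p} eq = does-true (onLine? d u v p) (trans (sym (lookup∘tabulate _ p)) eq)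

    transfer : line d u v ≡ line d w x → OnLine d u v p → OnLine d w x p
    transfer eq o = ∋⁻ (subst (_∋ _) eq (∋⁺ o))

    line-swap : ∀ u v → line d u v ≡ line d v u
    line-swap u v = tabulate-cong
      (λ p → does-⇔ (mk⇔ onLine-swap onLine-swap) (onLine? d u v p) (onLine? d v u p))

    ℒ : List (Subset n)
    ℒ = deduplicate _≟ᴸ_ (lines d)

    line∈ℒ : u ≢ v → line d u v ∈ ℒ
    line∈ℒ {u} {v} u≢v = ∈-deduplicate⁺ _≟ᴸ_ (∈-map⁺ (uncurry (line d))
      (∈-filter⁺ (λ (u , v) → ¬? (u ≟ v)) (∈-cartesianProduct⁺ (∈-allFin u) (∈-allFin v)) u≢v))

    -- Both `w` and `x` lie on the line of `u` and `v`, so each is one of these two or a common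
    -- neighbour of them. If one were an end and the other a common neighbour, `w` and `x` would be
    -- adjacent.
    far-lines : Far u v → Far w x → line d u v ≡ line d w x →
      (w ≡ u × x ≡ v) ⊎ (w ≡ v × x ≡ u) ⊎ ((Adj w u × Adj w v) × (Adj x u × Adj x v))
    far-lines f f′ eq with far-on⁻ f (transfer (sym eq) left-on) | far-on⁻ f (transfer (sym eq) right-on)
    ... | inj₁ refl             | inj₁ refl             = contradiction refl (far⇒≢ f′)
    ... | inj₁ refl             | inj₂ (inj₁ refl)      = inj₁ (refl , refl)
    ... | inj₁ refl             | inj₂ (inj₂ (a , _))   = contradiction (far-sym f′) (adj⇒¬far a)
    ... | inj₂ (inj₁ refl)      | inj₁ refl             = inj₂ (inj₁ (refl , refl))
    ... | inj₂ (inj₁ refl)      | inj₂ (inj₁ refl)      = contradiction refl (far⇒≢ f′)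
    ... | inj₂ (inj₁ refl)      | inj₂ (inj₂ (_ , a))   = contradiction (far-sym f′) (adj⇒¬far a)
    ... | inj₂ (inj₂ (a , _))   | inj₁ refl             = contradiction f′ (adj⇒¬far a)
    ... | inj₂ (inj₂ (_ , a))   | inj₂ (inj₁ refl)      = contradiction f′ (adj⇒¬far a)
    ... | inj₂ (inj₂ a)         | inj₂ (inj₂ b)         = inj₂ (inj₂ (a , b))

    Twin : Fin n → Fin n → Set
    Twin u v = Far u v × (∀ w → w ≢ u → w ≢ v → d u w ≡ d v w)

    HasTwin : Fin n → Set
    HasTwin u = ∃[ v ] Twin u v

    twin? : ∀ u v → Dec (Twin u v)
    twin? u v = (d u v ℕ.≟ 2) ×-dec
      Fin.all? (λ w → ¬? (w ≟ u) →-dec (¬? (w ≟ v) →-dec (d u w ℕ.≟ d v w)))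

    hasTwin? : ∀ u → Dec (HasTwin u)
    hasTwin? u = Fin.any? (twin? u)

    partner : Fin n → Fin n
    partner u with hasTwin? u
    ... | yes (v , _) = v
    -- A default; `partner-twin` describes `partner` only under `HasTwin`.
    ... | no _        = u

    partner-twin : HasTwin u → Twin u (partner u)
    partner-twin {u} h with hasTwin? u
    ... | yes (_ , t) = t
    ... | no ¬h       = contradiction h ¬h

    -- Another far pair with the same line would be adjacent to u and hence to
    -- its twin, putting the twin on the line.
    far-line-unique : HasTwin u → v ≢ partner u → Far u v → Far w x →
      line d u v ≡ line d w x → (w ≡ u × x ≡ v) ⊎ (w ≡ v × x ≡ u)
    far-line-unique {u} {v} {w} {x} h v≢u′ f f′ eq with far-lines f f′ eq
    ... | inj₁ same        = inj₁ same
    ... | inj₂ (inj₁ same) = inj₂ same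
    ... | inj₂ (inj₂ ((wu , _) , (xu , _))) = contradiction
      (far-on⁻ f (transfer (sym eq) (far-on⁺ f′ (u′-adj wu) (u′-adj xu)))) not-on
      where
      u′ : Fin n
      u′ = partner u

      twin : Twin u u′
      twin = partner-twin h

      u′-adj : ∀ {y} → Adj y u → Adj u′ y
      u′-adj {y} yu = trans
        (sym (proj₂ twin y (adj⇒≢ yu) λ { refl → adj⇒¬far yu (far-sym (proj₁ twin)) }))
        (adj-sym yu)

      not-on : ¬ (u′ ≡ u ⊎ u′ ≡ v ⊎ (Adj u′ u × Adj u′ v))
      not-on (inj₁ eq)              = far⇒≢ (proj₁ twin) (sym eq)
      not-on (inj₂ (inj₁ eq))       = v≢u′ (sym eq)
      not-on (inj₂ (inj₂ (a , _))) = adj⇒¬far a (far-sym (proj₁ twin))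

    private
      -- Such a `w` would separate `u` from exactly one of `v` and `x`, from `x` if adjacent to `u`
      -- and from `v` if far from it. It would then lie on just one of two equal lines.
      unseparated : line d u v ≡ line d u x → Adj u v → Adj u x →
                    w ≢ u → Adj w v → ¬ Far w x
      unseparated {u} {v} {x} {w} eq uv ux w≢u wv wx with adj⊎far w≢u
      ... | inj₁ a with adj-on⁻ uv (transfer (sym eq) (adj-on⁺ ux (inj₁ (a , wx))))
      ...   | inj₁ w≡u                     = w≢u w≡u
      ...   | inj₂ (inj₁ w≡v)              = adj⇒≢ wv w≡v
      ...   | inj₂ (inj₂ (inj₁ (_ , wv′))) = adj⇒¬far wv wv′
      ...   | inj₂ (inj₂ (inj₂ (wu , _)))  = adj⇒¬far a wu
      unseparated {u} {v} {x} {w} eq uv ux w≢u wv wx | inj₂ f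
        with adj-on⁻ ux (transfer eq (adj-on⁺ uv (inj₂ (f , wv))))
      ...   | inj₁ w≡u                     = w≢u w≡u
      ...   | inj₂ (inj₁ w≡x)              = far⇒≢ wx w≡x
      ...   | inj₂ (inj₂ (inj₁ (wu , _)))  = adj⇒¬far wu f
      ...   | inj₂ (inj₂ (inj₂ (_ , wx′))) = adj⇒¬far wx′ wx

    -- Otherwise `x`, being on the line of `u` and `v` and adjacent to `u`, is far from `v`, and
    -- `unseparated` in both directions makes `v` and `x` equidistant from every further point:
    -- twins.
    adj-lines-shared : Adj u v → Adj u x → line d u v ≡ line d u x → ¬ HasTwin v → v ≡ x
    adj-lines-shared {u} {v} {x} uv ux eq ¬h with v ≟ x
    ... | yes v≡x = v≡x
    ... | no v≢x  = contradiction (x , far-sym xv , same) ¬h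
      where
      xv : Far x v
      xv with adj-on⁻ uv (transfer (sym eq) right-on)
      ... | inj₁ x≡u                    = contradiction (sym x≡u) (adj⇒≢ ux)
      ... | inj₂ (inj₁ x≡v)             = contradiction (sym x≡v) v≢x
      ... | inj₂ (inj₂ (inj₁ (_ , f)))  = f
      ... | inj₂ (inj₂ (inj₂ (f , _)))  = contradiction (far-sym f) (adj⇒¬far ux)

      same : ∀ w → w ≢ v → w ≢ x → d v w ≡ d x w
      same w w≢v w≢x with w ≟ u
      ... | yes refl = trans (adj-sym uv) (sym (adj-sym ux))
      ... | no w≢u with adj⊎far w≢v | adj⊎far w≢x
      ...   | inj₁ a | inj₁ b = trans (adj-sym a) (sym (adj-sym b))
      ...   | inj₁ a | inj₂ b = contradiction b (unseparated eq uv ux w≢u a)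
      ...   | inj₂ a | inj₁ b = contradiction a (unseparated (sym eq) ux uv w≢u b)
      ...   | inj₂ a | inj₂ b = trans (far-sym a) (sym (far-sym b))

    -- For adjacent pairs `u`, `v` and `w`, `x` this says that the four points induce a four-cycle
    -- with the two pairs as opposite edges.
    Cross : Fin n → Fin n → Fin n → Fin n → Set
    Cross u v w x = (Adj u w × Far u x × Far v w × Adj v x) ⊎
                    (Far u w × Adj u x × Adj v w × Far v x)

    -- A shared end reduces to `adj-lines-shared`, up to reversing the pairs. With four distinct
    -- ends, `u` and `v` each separate `w` from `x`; as `w` also separates `u` from `v`, they do so
    -- in opposite ways, which leaves the two four-cycles.
    adj-lines : Adj u v → Adj w x → ¬ HasTwin u → ¬ HasTwin v → line d u v ≡ line d w x →
                (w ≡ u × x ≡ v) ⊎ (w ≡ v × x ≡ u) ⊎ Cross u v w x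
    adj-lines {u} {v} {w} {x} uv wx ¬hu ¬hv eq with w ≟ u | w ≟ v | x ≟ u | x ≟ v
    ... | yes refl | _ | _ | _ = inj₁ (refl , sym (adj-lines-shared uv wx eq ¬hv))
    ... | no _ | yes refl | _ | _ = inj₂ (inj₁ (refl , sym
      (adj-lines-shared (adj-sym uv) wx (trans (line-swap v u) eq) ¬hu)))
    ... | no _ | no _ | yes refl | _ = inj₂ (inj₁ (sym
      (adj-lines-shared uv (adj-sym wx) (trans eq (line-swap w u)) ¬hv) , refl))
    ... | no _ | no _ | no _ | yes refl = inj₁ (sym
      (adj-lines-shared (adj-sym uv) (adj-sym wx)
        (trans (line-swap v u) (trans eq (line-swap w v))) ¬hu) , refl)
    ... | no w≢u | no w≢v | no x≢u | no x≢v
      with adj-on⁻ wx (transfer eq left-on) | adj-on⁻ wx (transfer eq right-on)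
         | adj-on⁻ uv (transfer (sym eq) left-on)
    ... | inj₁ u≡w        | _ | _ = contradiction (sym u≡w) w≢u
    ... | inj₂ (inj₁ u≡x) | _ | _ = contradiction (sym u≡x) x≢u
    ... | inj₂ (inj₂ _) | inj₁ v≡w        | _ = contradiction (sym v≡w) w≢v
    ... | inj₂ (inj₂ _) | inj₂ (inj₁ v≡x) | _ = contradiction (sym v≡x) x≢v
    ... | inj₂ (inj₂ _) | inj₂ (inj₂ _) | inj₁ w≡u        = contradiction w≡u w≢u
    ... | inj₂ (inj₂ _) | inj₂ (inj₂ _) | inj₂ (inj₁ w≡v) = contradiction w≡v w≢v
    ... | inj₂ (inj₂ (inj₁ (uw , ux))) | inj₂ (inj₂ (inj₂ (vw , vx))) | inj₂ (inj₂ _) =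
      inj₂ (inj₂ (inj₁ (uw , ux , vw , vx)))
    ... | inj₂ (inj₂ (inj₂ (uw , ux))) | inj₂ (inj₂ (inj₁ (vw , vx))) | inj₂ (inj₂ _) =
      inj₂ (inj₂ (inj₂ (uw , ux , vw , vx)))
    ... | inj₂ (inj₂ (inj₁ (uw , _))) | inj₂ (inj₂ (inj₁ (vw , _))) | inj₂ (inj₂ (inj₁ (_ , wv))) =
      contradiction (far-sym wv) (adj⇒¬far vw)
    ... | inj₂ (inj₂ (inj₁ (uw , _))) | inj₂ (inj₂ (inj₁ (vw , _))) | inj₂ (inj₂ (inj₂ (wu , _))) =
      contradiction (far-sym wu) (adj⇒¬far uw)
    ... | inj₂ (inj₂ (inj₂ (uw , _))) | inj₂ (inj₂ (inj₂ (vw , _))) | inj₂ (inj₂ (inj₁ (wu , _))) =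
      contradiction (far-sym uw) (adj⇒¬far wu)
    ... | inj₂ (inj₂ (inj₂ (uw , _))) | inj₂ (inj₂ (inj₂ (vw , _))) | inj₂ (inj₂ (inj₂ (_ , wv))) =
      contradiction (far-sym vw) (adj⇒¬far wv)

    -- Were the pairs disjoint, `u` and `v` would be common neighbours of `w` and `x`. Then `w`
    -- would not separate `u` from `v`, although it has to lie on their line.
    adj-far-lines : Adj u v → Far w x → line d u v ≡ line d w x →
                    (u ≡ w ⊎ u ≡ x) ⊎ (v ≡ w ⊎ v ≡ x)
    adj-far-lines {u} {v} {w} {x} uv wx eq
      with far-on⁻ wx (transfer eq left-on) | far-on⁻ wx (transfer eq right-on)
    ... | inj₁ u≡w        | _               = inj₁ (inj₁ u≡w)
    ... | inj₂ (inj₁ u≡x) | _               = inj₁ (inj₂ u≡x)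
    ... | inj₂ (inj₂ _)   | inj₁ v≡w        = inj₂ (inj₁ v≡w)
    ... | inj₂ (inj₂ _)   | inj₂ (inj₁ v≡x) = inj₂ (inj₂ v≡x)
    ... | inj₂ (inj₂ (uw , _)) | inj₂ (inj₂ (vw , _)) with adj-on⁻ uv (transfer (sym eq) left-on)
    ...   | inj₁ w≡u                     = inj₁ (inj₁ (sym w≡u))
    ...   | inj₂ (inj₁ w≡v)              = inj₂ (inj₁ (sym w≡v))
    ...   | inj₂ (inj₂ (inj₁ (_ , wv)))  = contradiction (far-sym wv) (adj⇒¬far vw)
    ...   | inj₂ (inj₂ (inj₂ (wu , _)))  = contradiction (far-sym wu) (adj⇒¬far uw)

    private
      module Labelling {A : Set} (_≟ᴬ_ : DecidableEquality A) (Λ : A → A → Subset n) where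

        label : A × A → A ⊎ Subset n
        label (e , f) with e ≟ᴬ f
        ... | yes _ = inj₁ e
        ... | no _  = inj₂ (Λ e f)

    -- The k² ordered pairs from zs map at most two-to-one to k + N labels: a
    -- diagonal pair to its member, any other pair to its line.
    family-bound : ∀ {A : Set} (_≟ᴬ_ : DecidableEquality A) (Λ : A → A → Subset n)
      (_∋ᴬ_ : Subset n → A → Set) {zs} → Unique zs →
      (∀ {e f} → e ∈ zs → f ∈ zs → e ≢ f → Λ e f ∈ ℒ × Λ e f ∋ᴬ e × Λ e f ∋ᴬ f) →
      (∀ {e f g} → e ∈ zs → f ∈ zs → g ∈ zs → e ≢ f → Λ e f ∋ᴬ g → g ≡ e ⊎ g ≡ f) →
      length zs * length zs ≤ 2 * (length zs + numLines S)
    family-bound {A} _≟ᴬ_ Λ _∋ᴬ_ {zs} uzs contains only = subst₂ _≤_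
      (length-cartesianProduct zs zs)
      (cong (2 *_) (length-map-++-map zs ℒ))
      (twoToOne⇒length≤ (Sum.≡-dec _≟ᴬ_ _≟ᴸ_) label (Unique.cartesianProduct⁺ uzs uzs) cover mate)
      where
      open Labelling _≟ᴬ_ Λ

      cover : ∀ {a} → a ∈ cartesianProduct zs zs → label a ∈ map inj₁ zs ++ map inj₂ ℒ
      cover {e , f} ef∈ with e ≟ᴬ f | ∈-cartesianProduct⁻ zs zs ef∈
      ... | yes _  | e∈ , _  = ∈-++⁺ˡ (∈-map⁺ inj₁ e∈)
      ... | no e≢f | e∈ , f∈ = ∈-++⁺ʳ (map inj₁ zs) (∈-map⁺ inj₂ (proj₁ (contains e∈ f∈ e≢f)))

      mate : ∀ {a} → a ∈ cartesianProduct zs zs → ∃[ a′ ] ∀ {b} →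
             b ∈ cartesianProduct zs zs → label a ≡ label b → b ≡ a ⊎ b ≡ a′
      mate {e , f} ef∈ = (f , e) , same
        where
        same : ∀ {b} → b ∈ cartesianProduct zs zs → label (e , f) ≡ label b →
               b ≡ (e , f) ⊎ b ≡ (f , e)
        same {e′ , f′} ef′∈ eq with e ≟ᴬ f | e′ ≟ᴬ f′
        ... | yes refl | yes refl with refl ← inj₁-injective eq = inj₁ refl
        ... | no e≢f | no e′≢f′
          with ∈-cartesianProduct⁻ zs zs ef∈ | ∈-cartesianProduct⁻ zs zs ef′∈
        ... | e∈ , f∈ | e′∈ , f′∈
          -- The common line contains `e′` and `f′`, but no member of the family other than `e` and
          -- `f`; so the second pair is the first one or its reversal.
          with _ , e′-on , f′-on ← contains e′∈ f′∈ e′≢f′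
          with only e∈ f∈ e′∈ e≢f (subst (_∋ᴬ e′) (sym (inj₂-injective eq)) e′-on)
             | only e∈ f∈ f′∈ e≢f (subst (_∋ᴬ f′) (sym (inj₂-injective eq)) f′-on)
        ... | inj₁ refl | inj₁ refl = contradiction refl e′≢f′
        ... | inj₁ refl | inj₂ refl = inj₁ refl
        ... | inj₂ refl | inj₁ refl = inj₂ refl
        ... | inj₂ refl | inj₂ refl = contradiction refl e′≢f′

    -- Equality is included to make the relation reflexive, as `turán` requires; its independent
    -- sets are the cliques of adjacent points.
    Nonadjacent : Fin n → Fin n → Set
    Nonadjacent u v = u ≡ v ⊎ Far u v

    nonadjacent? : ∀ u v → Dec (Nonadjacent u v)
    nonadjacent? u v = (u ≟ v) ⊎-dec (d u v ℕ.≟ 2)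

    ¬nonadjacent⇒adj : ¬ Nonadjacent u v → Adj u v
    ¬nonadjacent⇒adj ¬n with adj⊎far (¬n ∘ inj₁)
    ... | inj₁ a = a
    ... | inj₂ f = contradiction (inj₂ f) ¬n

    -- A third member is adjacent to both `u` and `v`, so it does not separate them and is off their
    -- line.
    clique-bound : ∀ zs → AllPairs (λ u v → ¬ Nonadjacent u v) zs →
                   length zs * length zs ≤ 2 * (length zs + numLines S)
    clique-bound zs unr = family-bound _≟_ (line d) _∋_
      (AllPairs.map (λ ¬n u≡v → ¬n (inj₁ u≡v)) unr)
      (λ _ _ u≢v → line∈ℒ u≢v , ∋⁺ left-on , ∋⁺ right-on)
      only
      where
      adj : ∀ {u v} → u ∈ zs → v ∈ zs → u ≢ v → Adj u v
      adj = AllPairs-lookup adj-sym (AllPairs.map ¬nonadjacent⇒adj unr)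

      only : ∀ {u v p} → u ∈ zs → v ∈ zs → p ∈ zs → u ≢ v → line d u v ∋ p → p ≡ u ⊎ p ≡ v
      only {u} {v} {p} u∈ v∈ p∈ u≢v on with p ≟ u | p ≟ v
      ... | yes p≡u | _       = inj₁ p≡u
      ... | no _    | yes p≡v = inj₂ p≡v
      ... | no p≢u  | no p≢v with adj-on⁻ (adj u∈ v∈ u≢v) (∋⁻ on)
      ...   | inj₁ p≡u                    = inj₁ p≡u
      ...   | inj₂ (inj₁ p≡v)             = inj₂ p≡v
      ...   | inj₂ (inj₂ (inj₁ (_ , f)))  = contradiction f (adj⇒¬far (adj p∈ v∈ p≢v))
      ...   | inj₂ (inj₂ (inj₂ (f , _)))  = contradiction f (adj⇒¬far (adj p∈ u∈ p≢u))

  -- Counting pairs of points with twins and pairs of points without.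

  module _ {n : ℕ} (S : Space₁₂ n) where
    open Space₁₂ S

    private
      N : ℕ
      N = numLines S

    _≟ᴾ_ : DecidableEquality (Fin n × Fin n)
    _≟ᴾ_ = Product.≡-dec _≟_ _≟_

    -- Here `m` bounds the size of every family to which `family-bound` applies, in particular of
    -- every clique, so Turán's bound reduces the claim to counting nonadjacent pairs.
    twins-bound : ∀ m → (∀ k → k * k ≤ 2 * (k + N) → k ≤ m) →
                  ∀ ws → Unique ws → (∀ {u} → u ∈ ws → HasTwin S u) →
                  length ws * length ws ≤ m * (2 * (n + N))
    twins-bound m small ws uws twins = ≤-trans
      (turán (nonadjacent? S) (inj₁ refl) nonadjacent-sym m
        (λ zs unr → small (length zs) (clique-bound S zs unr)) ws)
      (*-monoʳ-≤ m pairs≤)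
      where
      nonadjacent-sym : Symmetric (Nonadjacent S)
      nonadjacent-sym (inj₁ u≡v) = inj₁ (sym u≡v)
      nonadjacent-sym (inj₂ f)   = inj₂ (far-sym S f)

      pairs : List (Fin n × Fin n)
      pairs = filter (λ (u , v) → nonadjacent? S u v) (cartesianProduct ws ws)

      -- The two exceptional pairs starting at `u`, namely (u, u) and (u, `partner S u`), share the
      -- label `u`. Any other pair in `pairs` is labelled by its line, which by `far-line-unique`
      -- determines it up to reversal.
      label : Fin n × Fin n → Fin n ⊎ Subset n
      label (u , v) with u ≟ v | v ≟ partner S u
      ... | no _ | no _ = inj₂ (line d u v)
      ... | _    | _    = inj₁ u

      member : ∀ {u v} → (u , v) ∈ pairs → HasTwin S u × Nonadjacent S u v
      member uv∈ with ∈-filter⁻ (λ (u , v) → nonadjacent? S u v) {xs = cartesianProduct ws ws} uv∈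
      ... | uv∈ws² , r = twins (proj₁ (∈-cartesianProduct⁻ ws ws uv∈ws²)) , r

      cover : ∀ {a} → a ∈ pairs → label a ∈ map inj₁ (allFin n) ++ map inj₂ (ℒ S)
      cover {u , v} _ with u ≟ v | v ≟ partner S u
      ... | no u≢v | no _  = ∈-++⁺ʳ (map inj₁ (allFin n)) (∈-map⁺ inj₂ (line∈ℒ S u≢v))
      ... | no _   | yes _ = ∈-++⁺ˡ (∈-map⁺ inj₁ (∈-allFin u))
      ... | yes _  | _     = ∈-++⁺ˡ (∈-map⁺ inj₁ (∈-allFin u))

      mate : Fin n × Fin n → Fin n × Fin n
      mate (u , v) with u ≟ v | v ≟ partner S u
      ... | no _ | no _ = v , u
      ... | no _ | yes _ = u , u
      ... | yes _ | _   = u , partner S u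

      same : ∀ {a b} → a ∈ pairs → b ∈ pairs → label a ≡ label b → b ≡ a ⊎ b ≡ mate a
      same {u , v} {w , x} a∈ b∈ eq
        with u ≟ v | v ≟ partner S u | w ≟ x | x ≟ partner S w
      ... | yes refl | _ | yes refl | _ with refl ← inj₁-injective eq = inj₁ refl
      ... | yes refl | _ | no _ | yes refl with refl ← inj₁-injective eq = inj₂ refl
      ... | no _ | yes refl | yes refl | _ with refl ← inj₁-injective eq = inj₂ refl
      ... | no _ | yes refl | no _ | yes refl with refl ← inj₁-injective eq = inj₁ refl
      ... | no u≢v | no v≢u′ | no w≢x | no _ with member a∈ | member b∈
      ... | _ , inj₁ u≡v | _            = contradiction u≡v u≢v
      ... | _ , inj₂ _   | _ , inj₁ w≡x = contradiction w≡x w≢x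
      ... | h , inj₂ f   | _ , inj₂ f′ with far-line-unique S h v≢u′ f f′ (inj₂-injective eq)
      ...   | inj₁ (refl , refl) = inj₁ refl
      ...   | inj₂ (refl , refl) = inj₂ refl

      pairs≤ : length pairs ≤ 2 * (n + N)
      pairs≤ = subst (λ l → length pairs ≤ 2 * l)
        (trans (length-map-++-map (allFin n) (ℒ S)) (cong (_+ N) (length-tabulate {n = n} id)))
        (twoToOne⇒length≤ (Sum.≡-dec _≟_ _≟ᴸ_) label
          (Unique.filter⁺ (λ (u , v) → nonadjacent? S u v) (Unique.cartesianProduct⁺ uws uws))
          cover (λ {a} a∈ → mate a , same a∈))

    module _ (m : ℕ) (small : ∀ k → k * k ≤ 2 * (k + N) → k ≤ m) where

      -- The field `ordered` keeps one of the two orders of a pair, which rules out the reversal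
      -- allowed by `far-lines` and `adj-lines`.
      record Generator (L : Subset n) (e : Fin n × Fin n) : Set where
        field
          ordered : proj₁ e Fin.< proj₂ e
          twinlessˡ : ¬ HasTwin S (proj₁ e)
          twinlessʳ : ¬ HasTwin S (proj₂ e)
          generates : uncurry (line d) e ≡ L

      open Generator

      private
        _∋ᴾ_ : Subset n → Fin n × Fin n → Set
        L ∋ᴾ (u , v) = (_∋_ S L u) × (_∋_ S L v)

        swapped : ∀ {L u v w x} {A : Set} → Generator L (u , v) → Generator L (w , x) →
                  w ≡ v → x ≡ u → A
        swapped g g′ refl refl = contradiction (ordered g) (Fin.<-asym (ordered g′))

      module _ {L : Subset n} where

        far-cross : ∀ {u v w x} → Generator L (u , v) → Generator L (w , x) →
                    Far S u v → Far S w x → (u , v) ≢ (w , x) →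
                    (Adj S w u × Adj S w v) × (Adj S x u × Adj S x v)
        far-cross g g′ f f′ e≢e′ with far-lines S f f′ (trans (generates g) (sym (generates g′)))
        ... | inj₁ (refl , refl)      = contradiction refl e≢e′
        ... | inj₂ (inj₁ (w≡v , x≡u)) = swapped g g′ w≡v x≡u
        ... | inj₂ (inj₂ cross)       = cross

        adj-cross : ∀ {u v w x} → Generator L (u , v) → Generator L (w , x) →
                    Adj S u v → Adj S w x → (u , v) ≢ (w , x) → Cross S u v w x
        adj-cross g g′ a a′ e≢e′
          with adj-lines S a a′ (twinlessˡ g) (twinlessʳ g) (trans (generates g) (sym (generates g′)))
        ... | inj₁ (refl , refl)      = contradiction refl e≢e′
        ... | inj₂ (inj₁ (w≡v , x≡u)) = swapped g g′ w≡v x≡u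
        ... | inj₂ (inj₂ cross)       = cross

        -- Ends of different pairs are adjacent, ends of the same pair are far. So the second ends
        -- `v` and `x` separate the first ends `u` and `w` and lie on their line, while the ends of
        -- a third pair are adjacent to both and do not.
        far-generators : ∀ es → Unique es → (∀ {e} → e ∈ es → Generator L e × uncurry (Far S) e) →
                         length es ≤ m
        far-generators es ues gen = small (length es)
          (family-bound S _≟ᴾ_ Λ _∋ᴾ_ ues contains only)
          where
          Λ : Fin n × Fin n → Fin n × Fin n → Subset n
          Λ (u , v) (w , x) = line d u w

          contains : ∀ {e f} → e ∈ es → f ∈ es → e ≢ f →
                     Λ e f ∈ ℒ S × Λ e f ∋ᴾ e × Λ e f ∋ᴾ f
          contains {u , v} {w , x} e∈ f∈ e≢f with gen e∈ | gen f∈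
          ... | g , uv | g′ , wx with far-cross g g′ uv wx e≢f
          ... | (wu , wv) , (xu , xv) =
            line∈ℒ S (adj⇒≢ S (adj-sym S wu)) ,
            (∋⁺ S (left-on S) , ∋⁺ S (adj-on⁺ S (adj-sym S wu) (inj₂ (far-sym S uv , adj-sym S wv)))) ,
            (∋⁺ S (right-on S) , ∋⁺ S (adj-on⁺ S (adj-sym S wu) (inj₁ (xu , far-sym S wx))))

          only : ∀ {e f g} → e ∈ es → f ∈ es → g ∈ es → e ≢ f → Λ e f ∋ᴾ g → g ≡ e ⊎ g ≡ f
          only {e@(u , v)} {f@(w , x)} {g@(p , q)} e∈ f∈ g∈ e≢f (p-on , _) with g ≟ᴾ e | g ≟ᴾ f
          ... | yes g≡e | _       = inj₁ g≡e
          ... | no _    | yes g≡f = inj₂ g≡f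
          ... | no g≢e  | no g≢f  with gen e∈ | gen f∈ | gen g∈
          ... | ge , uv | gf , wx | gg , pq
            with (wu , _) , _ ← far-cross ge gf uv wx e≢f
               | (pu , _) , _ ← far-cross ge gg uv pq (≢-sym g≢e)
               | (pw , _) , _ ← far-cross gf gg wx pq (≢-sym g≢f)
            with adj-on⁻ S (adj-sym S wu) (∋⁻ S p-on)
          ... | inj₁ p≡u                   = contradiction p≡u (adj⇒≢ S pu)
          ... | inj₂ (inj₁ p≡w)            = contradiction p≡w (adj⇒≢ S pw)
          ... | inj₂ (inj₂ (inj₁ (_ , f))) = contradiction f (adj⇒¬far S pw)
          ... | inj₂ (inj₂ (inj₂ (f , _))) = contradiction f (adj⇒¬far S pu)

        -- Two of these pairs are opposite edges of an induced four-cycle. The line of a diagonal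
        -- contains the whole cycle, since the other two vertices are common neighbours of its ends.
        adj-generators : ∀ es → Unique es → (∀ {e} → e ∈ es → Generator L e × uncurry (Adj S) e) →
                         length es ≤ m
        adj-generators es ues gen = small (length es)
          (family-bound S _≟ᴾ_ Λ _∋ᴾ_ ues contains only)
          where
          -- Exactly one of w and x is far from u, so this is the line of a far pair.
          Λ : Fin n × Fin n → Fin n × Fin n → Subset n
          Λ (u , v) (w , x) with d u w ℕ.≟ 2
          ... | yes _ = line d u w
          ... | no _  = line d u x

          contains : ∀ {e f} → e ∈ es → f ∈ es → e ≢ f →
                     Λ e f ∈ ℒ S × Λ e f ∋ᴾ e × Λ e f ∋ᴾ f
          contains {u , v} {w , x} e∈ f∈ e≢f with gen e∈ | gen f∈
          ... | g , uv | g′ , wx with adj-cross g g′ uv wx e≢f | d u w ℕ.≟ 2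
          ... | inj₁ (uw , _ , _ , _)     | yes f = contradiction f (adj⇒¬far S uw)
          ... | inj₂ (uw , _ , _ , _)     | no ¬f = contradiction uw ¬f
          ... | inj₁ (uw , ux , vw , vx)  | no _  =
            line∈ℒ S (far⇒≢ S ux) ,
            (∋⁺ S (left-on S) , ∋⁺ S (far-on⁺ S ux (adj-sym S uv) vx)) ,
            (∋⁺ S (far-on⁺ S ux (adj-sym S uw) wx) , ∋⁺ S (right-on S))
          ... | inj₂ (uw , ux , vw , vx)  | yes _ =
            line∈ℒ S (far⇒≢ S uw) ,
            (∋⁺ S (left-on S) , ∋⁺ S (far-on⁺ S uw (adj-sym S uv) vw)) ,
            (∋⁺ S (right-on S) , ∋⁺ S (far-on⁺ S uw (adj-sym S ux) (adj-sym S wx)))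

          -- One end of (p , q) is far from u, hence off the line of the far pair u, y.
          outside : ∀ {u v p q y} → Cross S u v p q → Far S u y → p ≢ y → q ≢ y →
                    ¬ line d u y ∋ᴾ (p , q)
          outside (inj₁ (up , uq , _)) uy p≢y q≢y (_ , q-on) with far-on⁻ S uy (∋⁻ S q-on)
          ... | inj₁ q≡u            = far⇒≢ S uq (sym q≡u)
          ... | inj₂ (inj₁ q≡y)     = q≢y q≡y
          ... | inj₂ (inj₂ (a , _)) = adj⇒¬far S a (far-sym S uq)
          outside (inj₂ (up , uq , _)) uy p≢y q≢y (p-on , _) with far-on⁻ S uy (∋⁻ S p-on)
          ... | inj₁ p≡u            = far⇒≢ S up (sym p≡u)
          ... | inj₂ (inj₁ p≡y)     = p≢y p≡y
          ... | inj₂ (inj₂ (a , _)) = adj⇒¬far S a (far-sym S up)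

          disjoint : ∀ {w x p q} → Cross S w x p q → (p ≢ w × q ≢ w) × (p ≢ x × q ≢ x)
          disjoint (inj₁ (wp , wq , xp , xq)) =
            (≢-sym (adj⇒≢ S wp) , ≢-sym (far⇒≢ S wq)) , (≢-sym (far⇒≢ S xp) , ≢-sym (adj⇒≢ S xq))
          disjoint (inj₂ (wp , wq , xp , xq)) =
            (≢-sym (far⇒≢ S wp) , ≢-sym (adj⇒≢ S wq)) , (≢-sym (adj⇒≢ S xp) , ≢-sym (far⇒≢ S xq))

          only : ∀ {e f g} → e ∈ es → f ∈ es → g ∈ es → e ≢ f → Λ e f ∋ᴾ g → g ≡ e ⊎ g ≡ f
          only {e@(u , v)} {f@(w , x)} {g@(p , q)} e∈ f∈ g∈ e≢f on with g ≟ᴾ e | g ≟ᴾ f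
          ... | yes g≡e | _       = inj₁ g≡e
          ... | no _    | yes g≡f = inj₂ g≡f
          ... | no g≢e  | no g≢f  with gen e∈ | gen f∈ | gen g∈
          ... | ge , uv | gf , wx | gg , pq
            with disjoint (adj-cross gf gg wx pq (≢-sym g≢f)) | d u w ℕ.≟ 2
          ... | (p≢w , q≢w) , _ | yes uw = contradiction on
            (outside (adj-cross ge gg uv pq (≢-sym g≢e)) uw p≢w q≢w)
          ... | _ , (p≢x , q≢x) | no ¬uw with adj-cross ge gf uv wx e≢f
          ...   | inj₁ (_ , ux , _) = contradiction on
            (outside (adj-cross ge gg uv pq (≢-sym g≢e)) ux p≢x q≢x)
          ...   | inj₂ (uw , _)     = contradiction uw ¬uw

        -- Far pairs with the same line are disjoint, and each of these meets {p , q}.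
        mixed-generators : ∀ {p q} → Adj S p q → line d p q ≡ L →
          ∀ es → Unique es → (∀ {e} → e ∈ es → Generator L e × uncurry (Far S) e) →
          length es ≤ 2
        mixed-generators {p} {q} pq eqL es ues gen =
          -- By `adj-far-lines` a pair that misses `p` contains `q`, and by `shared` at most one
          -- pair passes through each of these points.
          injective⇒length≤ Bool._≟_ hits-p {ys = true ∷ false ∷ []} ues (λ _ → both _) inj
          where
          hits? : ∀ z e → Dec (z ≡ proj₁ e ⊎ z ≡ proj₂ e)
          hits? z (u , v) = (z ≟ u) ⊎-dec (z ≟ v)

          hits-p : Fin n × Fin n → Bool
          hits-p e = does (hits? p e)

          both : ∀ b → b ∈ true ∷ false ∷ []
          both true  = here refl
          both false = there (here refl)

          shared : ∀ {z e f} → Generator L e → Generator L f → uncurry (Far S) e → uncurry (Far S) f →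
                   z ≡ proj₁ e ⊎ z ≡ proj₂ e → z ≡ proj₁ f ⊎ z ≡ proj₂ f → f ≡ e
          shared {z} {e} {f} ge gf fe ff ze zf with e ≟ᴾ f
          ... | yes e≡f = sym e≡f
          ... | no e≢f with far-cross ge gf fe ff e≢f | ze | zf
          ... | (wu , wv) , (xu , xv) | inj₁ refl | inj₁ eq = contradiction (sym eq) (adj⇒≢ S wu)
          ... | (wu , wv) , (xu , xv) | inj₁ refl | inj₂ eq = contradiction (sym eq) (adj⇒≢ S xu)
          ... | (wu , wv) , (xu , xv) | inj₂ refl | inj₁ eq = contradiction (sym eq) (adj⇒≢ S wv)
          ... | (wu , wv) , (xu , xv) | inj₂ refl | inj₂ eq = contradiction (sym eq) (adj⇒≢ S xv)

          inj : ∀ {e f} → e ∈ es → f ∈ es → hits-p e ≡ hits-p f → f ≡ e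
          inj {e} {f} e∈ f∈ eq with gen e∈ | gen f∈
          ... | ge , fe | gf , ff
            with hits? p e | hits? p f
               | adj-far-lines S pq fe (trans eqL (sym (generates ge)))
               | adj-far-lines S pq ff (trans eqL (sym (generates gf)))
          ... | yes a | no ¬b | _ | _ =
            contradiction (does-true (hits? p f) (trans (sym eq) (dec-true (hits? p e) a))) ¬b
          ... | no ¬a | yes b | _ | _ =
            contradiction (does-true (hits? p e) (trans eq (dec-true (hits? p f) b))) ¬a
          ... | yes a | yes b | _ | _ = shared ge gf fe ff a b
          ... | no ¬a | no ¬b | inj₁ a | _ = contradiction a ¬a
          ... | no ¬a | no ¬b | inj₂ _ | inj₁ b = contradiction b ¬b
          ... | no ¬a | no ¬b | inj₂ a | inj₂ b = shared ge gf fe ff a b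

        -- Adjacent and far pairs number at most `m` each, but a single adjacent pair leaves room
        -- for only two far ones. Adding the two bounds to 2 m instead would cost a factor of two in
        -- the twinless case and spoil α.
        generators : ∀ es → Unique es → (∀ {e} → e ∈ es → Generator L e) → length es ≤ m + 2
        generators es ues gen = begin
          length es
            ≡⟨ length-filter-¬ adj? es ⟩
          length (filter adj? es) + length (filter (¬? ∘ adj?) es)
            ≤⟨ bound ⟩
          m + 2 ∎
          where
          open ≤-Reasoning
          adj? : (e : Fin n × Fin n) → Dec (uncurry (Adj S) e)
          adj? (u , v) = d u v ℕ.≟ 1

          gen-adj : ∀ {e} → e ∈ filter adj? es → Generator L e × uncurry (Adj S) e
          gen-adj e∈ with ∈-filter⁻ adj? {xs = es} e∈
          ... | e∈es , a = gen e∈es , a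

          gen-far : ∀ {e} → e ∈ filter (¬? ∘ adj?) es → Generator L e × uncurry (Far S) e
          gen-far e∈ with ∈-filter⁻ (¬? ∘ adj?) {xs = es} e∈
          ... | e∈es , ¬a = gen e∈es , ¬adj⇒far S (Fin.<⇒≢ (ordered (gen e∈es))) ¬a

          split : ∀ xs (ys : List (Fin n × Fin n)) → length xs ≤ m → length ys ≤ m →
                  (∀ {e : Fin n × Fin n} → e ∈ xs → length ys ≤ 2) → length xs + length ys ≤ m + 2
          split []      _ _   ≤m _  = ≤-trans ≤m (m≤m+n m 2)
          split (_ ∷ _) _ ≤m′ _  ≤2 = +-mono-≤ ≤m′ (≤2 (here refl))

          bound : length (filter adj? es) + length (filter (¬? ∘ adj?) es) ≤ m + 2
          bound = split (filter adj? es) (filter (¬? ∘ adj?) es)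
            (adj-generators _ (Unique.filter⁺ adj? ues) gen-adj)
            (far-generators _ ufar gen-far)
            (λ e∈ → mixed-generators (proj₂ (gen-adj e∈)) (generates (proj₁ (gen-adj e∈)))
              _ ufar gen-far)
            where
            ufar : Unique (filter (¬? ∘ adj?) es)
            ufar = Unique.filter⁺ (¬? ∘ adj?) ues

      -- Ordered pairs are reduced two-to-one to increasing ones, with separate labels for the
      -- diagonal, and the increasing pairs are counted line by line through `generators`.
      twinless-bound : ∀ ws → Unique ws → (∀ {u} → u ∈ ws → ¬ HasTwin S u) →
                       length ws * length ws ≤ 2 * (length ws + (m + 2) * N)
      twinless-bound ws uws twinless = begin
        length ws * length ws
          ≡⟨ length-cartesianProduct ws ws ⟨
        length (cartesianProduct ws ws)
          ≤⟨ twoToOne⇒length≤ (Sum.≡-dec _≟_ _≟ᴾ_) label (Unique.cartesianProduct⁺ uws uws)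
               cover (λ {a} _ → swap a , same a) ⟩
        2 * length (map inj₁ ws ++ map inj₂ pairs)
          ≡⟨ cong (2 *_) (length-map-++-map ws pairs) ⟩
        2 * (length ws + length pairs)
          ≤⟨ *-monoʳ-≤ 2 (+-monoʳ-≤ (length ws) pairs≤) ⟩
        2 * (length ws + (m + 2) * N) ∎
        where
        open ≤-Reasoning
        pairs : List (Fin n × Fin n)
        pairs = filter (λ (u , v) → u Fin.<? v) (cartesianProduct ws ws)

        label : Fin n × Fin n → Fin n ⊎ (Fin n × Fin n)
        label (u , v) with Fin.<-cmp u v
        ... | tri< _ _ _ = inj₂ (u , v)
        ... | tri≈ _ _ _ = inj₁ u
        ... | tri> _ _ _ = inj₂ (v , u)

        cover : ∀ {a} → a ∈ cartesianProduct ws ws → label a ∈ map inj₁ ws ++ map inj₂ pairs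
        cover {u , v} uv∈ with Fin.<-cmp u v | ∈-cartesianProduct⁻ ws ws uv∈
        ... | tri< u<v _ _ | u∈ , v∈ = ∈-++⁺ʳ (map inj₁ ws) (∈-map⁺ inj₂
          (∈-filter⁺ (λ (u , v) → u Fin.<? v) (∈-cartesianProduct⁺ u∈ v∈) u<v))
        ... | tri≈ _ _ _   | u∈ , v∈ = ∈-++⁺ˡ (∈-map⁺ inj₁ u∈)
        ... | tri> _ _ v<u | u∈ , v∈ = ∈-++⁺ʳ (map inj₁ ws) (∈-map⁺ inj₂
          (∈-filter⁺ (λ (u , v) → u Fin.<? v) (∈-cartesianProduct⁺ v∈ u∈) v<u))

        same : ∀ a {b} → b ∈ cartesianProduct ws ws → label a ≡ label b → b ≡ a ⊎ b ≡ swap a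
        same (u , v) {w , x} _ eq with Fin.<-cmp u v | Fin.<-cmp w x
        ... | tri≈ _ refl _ | tri≈ _ refl _ with refl ← inj₁-injective eq = inj₁ refl
        ... | tri< _ _ _ | tri< _ _ _ with refl ← inj₂-injective eq = inj₁ refl
        ... | tri< _ _ _ | tri> _ _ _ with refl ← inj₂-injective eq = inj₂ refl
        ... | tri> _ _ _ | tri< _ _ _ with refl ← inj₂-injective eq = inj₂ refl
        ... | tri> _ _ _ | tri> _ _ _ with refl ← inj₂-injective eq = inj₁ refl

        member : ∀ {a} → a ∈ pairs → a ∈ cartesianProduct ws ws × proj₁ a Fin.< proj₂ a
        member = ∈-filter⁻ (λ (u , v) → u Fin.<? v) {xs = cartesianProduct ws ws}

        pairs≤ : length pairs ≤ (m + 2) * N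
        pairs≤ = length≤fibres _≟ᴸ_ (uncurry (line d)) (m + 2) pairs (ℒ S)
          (λ a∈ → line∈ℒ S (Fin.<⇒≢ (proj₂ (member a∈))))
          (λ {L} _ → generators _
            (Unique.filter⁺ (λ a → uncurry (line d) a ≟ᴸ L)
              (Unique.filter⁺ (λ (u , v) → u Fin.<? v) (Unique.cartesianProduct⁺ uws uws)))
            generator)
          where
          generator : ∀ {L a} → a ∈ fibre _≟ᴸ_ (uncurry (line d)) pairs L → Generator L a
          generator {L} {u , v} a∈ with ∈-filter⁻ (λ a → uncurry (line d) a ≟ᴸ L) {xs = pairs} a∈
          ... | a∈pairs , eq with member a∈pairs
          ... | a∈ws² , u<v with ∈-cartesianProduct⁻ ws ws a∈ws²
          ... | u∈ , v∈ = record
            { ordered = u<v ; twinlessˡ = twinless u∈ ; twinlessʳ = twinless v∈ ; generates = eq }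

    -- The larger of the two classes has c points with n ≤ 2 c, and in either class c² ≤ 2 K; hence
    -- the factor 4 · 2 = 8.
    quadratic-bound : ∀ m → (∀ k → k * k ≤ 2 * (k + N) → k ≤ m) →
                      n * n ≤ 8 * ((m + 2) * (n + N))
    quadratic-bound m small = case
      where
      open ≤-Reasoning
      with-twin without : List (Fin n)
      with-twin = filter (hasTwin? S) (allFin n)
      without   = filter (¬? ∘ hasTwin? S) (allFin n)

      a b K : ℕ
      a = length with-twin
      b = length without
      K = (m + 2) * (n + N)

      n≡a+b : n ≡ a + b
      n≡a+b = trans (sym (length-tabulate {n = n} id)) (length-filter-¬ (hasTwin? S) (allFin n))

      b≤n : b ≤ n
      b≤n = ≤-trans (m≤n+m b a) (≤-reflexive (sym n≡a+b))

      half : ∀ c → n ≤ c + c → c * c ≤ 2 * K → n * n ≤ 8 * K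
      half c n≤2c c²≤2K = begin
        n * n             ≤⟨ *-mono-≤ n≤2c n≤2c ⟩
        (c + c) * (c + c) ≡⟨ square c ⟩
        4 * (c * c)       ≤⟨ *-monoʳ-≤ 4 c²≤2K ⟩
        4 * (2 * K)       ≡⟨ *-assoc 4 2 K ⟨
        8 * K             ∎
        where
        square : ∀ c → (c + c) * (c + c) ≡ 4 * (c * c)
        square = solve-∀

      twin-case : a * a ≤ 2 * K
      twin-case = begin
        a * a
          ≤⟨ twins-bound m small with-twin (Unique.filter⁺ (hasTwin? S) (Unique.allFin⁺ n))
               (λ u∈ → proj₂ (∈-filter⁻ (hasTwin? S) {xs = allFin n} u∈)) ⟩
        m * (2 * (n + N))
          ≡⟨ swap₂ m (n + N) ⟩
        2 * (m * (n + N))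
          ≤⟨ *-monoʳ-≤ 2 (*-monoˡ-≤ (n + N) (m≤m+n m 2)) ⟩
        2 * K ∎
        where
        swap₂ : ∀ m k → m * (2 * k) ≡ 2 * (m * k)
        swap₂ = solve-∀

      twinless-case : b * b ≤ 2 * K
      twinless-case = begin
        b * b
          ≤⟨ twinless-bound m small without (Unique.filter⁺ (¬? ∘ hasTwin? S) (Unique.allFin⁺ n))
               (λ u∈ → proj₂ (∈-filter⁻ (¬? ∘ hasTwin? S) {xs = allFin n} u∈)) ⟩
        2 * (b + (m + 2) * N)
          ≤⟨ *-monoʳ-≤ 2 (+-monoˡ-≤ ((m + 2) * N) b≤) ⟩
        2 * ((m + 2) * n + (m + 2) * N)
          ≡⟨ cong (2 *_) (*-distribˡ-+ (m + 2) n N) ⟨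
        2 * K ∎
        where
        b≤ : b ≤ (m + 2) * n
        b≤ = ≤-trans b≤n (≤-trans (m≤n*m n 2) (*-monoˡ-≤ n (m≤n+m 2 m)))

      case : n * n ≤ 8 * K
      case with ≤-total a b
      ... | inj₁ a≤b = half b (≤-trans (≤-reflexive n≡a+b) (+-monoˡ-≤ b a≤b)) twinless-case
      ... | inj₂ b≤a = half a (≤-trans (≤-reflexive n≡a+b) (+-monoʳ-≤ a b≤a)) twin-case

-- Complete multipartite graphs

module PartiteLines where

  open import Data.Nat.Base
  open import Data.Nat.Properties hiding (_≟_)
  open import Data.Nat.DivMod using (_/_; _%_; m≡m%n+[m/n]*n; m%n<n; /-monoˡ-≤)
  open Counting
  open Lines

  orderedPairs : ℕ → List (ℕ × ℕ)
  orderedPairs zero    = []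
  orderedPairs (suc k) = map (_, k) (upTo k) ++ orderedPairs k

  ∈-orderedPairs : ∀ {i j} k → i < j → j < k → (i , j) ∈ orderedPairs k
  ∈-orderedPairs {i} {j} (suc k) i<j (s≤s j≤k) with j ℕ.≟ k
  ... | yes refl = ∈-++⁺ˡ (∈-map⁺ (_, k) (∈-upTo⁺ i<j))
  ... | no j≢k   = ∈-++⁺ʳ (map (_, k) (upTo k)) (∈-orderedPairs k i<j (≤∧≢⇒< j≤k j≢k))

  -- The exact value k (k - 1) is relaxed to keep subtraction out of the later arithmetic; the loss
  -- is of lower order.
  length-orderedPairs : ∀ k → 2 * length (orderedPairs k) ≤ k * k
  length-orderedPairs zero    = z≤n
  length-orderedPairs (suc k) = begin
    2 * length (orderedPairs (suc k))
      ≡⟨ cong (2 *_) (trans (length-++ (map (_, k) (upTo k)))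
           (cong (_+ length (orderedPairs k)) (trans (length-map (_, k) (upTo k)) (length-upTo k)))) ⟩
    2 * (k + length (orderedPairs k))
      ≡⟨ *-distribˡ-+ 2 k _ ⟩
    2 * k + 2 * length (orderedPairs k)
      ≤⟨ +-monoʳ-≤ (2 * k) (length-orderedPairs k) ⟩
    2 * k + k * k
      ≤⟨ n≤1+n _ ⟩
    1 + (2 * k + k * k)
      ≡⟨ expand k ⟩
    suc k * suc k ∎
    where
    open ≤-Reasoning
    expand : ∀ k → 1 + (2 * k + k * k) ≡ (1 + k) * (1 + k)
    expand = solve-∀

  module _ {n : ℕ} (E : Fin n → Fin n → Bool) {x y : Fin n} (x≢y : x ≢ y) where

    graphDistance-1 : E x y ≡ true → E y x ≡ true → graphDistance E x y ≡ 1
    graphDistance-1 exy eyx with x ≟ y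
    ... | yes x≡y = contradiction x≡y x≢y
    ... | no _ rewrite exy | eyx = refl

    graphDistance-2 : E x y ≡ false → graphDistance E x y ≡ 2
    graphDistance-2 exy with x ≟ y
    ... | yes x≡y = contradiction x≡y x≢y
    ... | no _ rewrite exy = refl

  module Multipartite (n s : ℕ) .{{_ : NonZero s}} where

    part : Fin n → ℕ
    part z = toℕ z / s

    samePart? : ∀ x y → Dec (part x ≡ part y)
    samePart? x y = part x ℕ.≟ part y

    edge : Fin n → Fin n → Bool
    edge x y = not (does (samePart? x y))

    space : Space₁₂ n
    space = graphSpace edge

    private
      d : Fin n → Fin n → ℕ
      d = Space₁₂.d space

      -- One more than the quotient, to allow for an incomplete last part.
      p : ℕ
      p = suc (n / s)

      variable
        x y z : Fin n

    far : x ≢ y → part x ≡ part y → Far space x y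
    far {x} {y} x≢y eq = graphDistance-2 edge x≢y (cong not (dec-true (samePart? x y) eq))

    adj : part x ≢ part y → Adj space x y
    adj {x} {y} ≢ = graphDistance-1 edge (≢ ∘ cong part)
      (cong not (dec-false (samePart? x y) ≢)) (cong not (dec-false (samePart? y x) (≢-sym ≢)))

    adj⇒part≢ : Adj space x y → part x ≢ part y
    adj⇒part≢ {x} {y} a eq =
      adj⇒¬far space {x} {y} a (far (adj⇒≢ space {x} {y} a) eq)

    far⇒part≡ : Far space x y → part x ≡ part y
    far⇒part≡ {x} {y} f with samePart? x y
    ... | yes eq = eq
    ... | no ≢   = contradiction f (adj⇒¬far space {x} {y} (adj ≢))

    inside? : ∀ q a b (z : Fin n) → Dec (part z ≢ q ⊎ toℕ z ≡ a ⊎ toℕ z ≡ b)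
    inside? q a b z = ¬? (part z ℕ.≟ q) ⊎-dec (toℕ z ℕ.≟ a) ⊎-dec (toℕ z ℕ.≟ b)

    across? : ∀ q q′ (z : Fin n) → Dec (part z ≡ q ⊎ part z ≡ q′)
    across? q q′ z = (part z ℕ.≟ q) ⊎-dec (part z ℕ.≟ q′)

    -- The pair is given by the index of its part and two remainders, all natural numbers, so that
    -- every part offers the same choices. A position beyond the last point just matches no `z`.
    insideLine : ℕ × ℕ × ℕ → Subset n
    insideLine (q , r , r′) = tabulate (λ z → does (inside? q (r + q * s) (r′ + q * s) z))

    acrossLine : ℕ × ℕ → Subset n
    acrossLine (q , q′) = tabulate (λ z → does (across? q q′ z))

    candidates : List (Subset n)
    candidates = map insideLine (cartesianProduct (upTo p) (orderedPairs s)) ++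
                 map acrossLine (orderedPairs p)

    private
      line-inside : x ≢ y → part x ≡ part y →
                    line d x y ≡ insideLine (part x , toℕ x % s , toℕ y % s)
      line-inside {x} {y} x≢y eq = tabulate-cong λ z →
        does-⇔ (mk⇔ to from) (onLine? d x y z)
          (inside? (part x) (toℕ x % s + part x * s) (toℕ y % s + part x * s) z)
        where
        to : OnLine d x y z → part z ≢ part x ⊎ toℕ z ≡ toℕ x % s + part x * s ⊎
                              toℕ z ≡ toℕ y % s + part x * s
        to {z} on with far-on⁻ space {x} {y} {z} (far x≢y eq) on
        ... | inj₁ refl            = inj₂ (inj₁ (m≡m%n+[m/n]*n (toℕ x) s))
        ... | inj₂ (inj₁ refl)     = inj₂ (inj₂ (trans (m≡m%n+[m/n]*n (toℕ y) s)
          (cong (λ q → toℕ y % s + q * s) (sym eq))))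
        ... | inj₂ (inj₂ (a , _))  = inj₁ (adj⇒part≢ a)

        from : part z ≢ part x ⊎ toℕ z ≡ toℕ x % s + part x * s ⊎
               toℕ z ≡ toℕ y % s + part x * s → OnLine d x y z
        from {z} (inj₁ ≢) = far-on⁺ space {x} {y} {z} (far x≢y eq) (adj ≢) (adj (≢ ∘ (λ e → trans e (sym eq))))
        from {z} (inj₂ (inj₁ e)) =
          inj₂ (inj₁ (toℕ-injective (trans e (sym (m≡m%n+[m/n]*n (toℕ x) s)))))
        from {z} (inj₂ (inj₂ e)) =
          inj₂ (inj₂ (inj₂ (inj₁ (toℕ-injective (trans e (trans
            (cong (λ q → toℕ y % s + q * s) eq) (sym (m≡m%n+[m/n]*n (toℕ y) s))))))))

      -- Among the points other than `x` and `y`, those separating the two are the ones in the part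
      -- of either, since a point of a third part is adjacent to both.
      line-across : part x ≢ part y → line d x y ≡ acrossLine (part x , part y)
      line-across {x} {y} ≢ = tabulate-cong λ z →
        does-⇔ (mk⇔ to from) (onLine? d x y z) (across? (part x) (part y) z)
        where
        to : OnLine d x y z → part z ≡ part x ⊎ part z ≡ part y
        to {z} on with adj-on⁻ space {x} {y} {z} (adj ≢) on
        ... | inj₁ refl                   = inj₁ refl
        ... | inj₂ (inj₁ refl)            = inj₂ refl
        ... | inj₂ (inj₂ (inj₁ (_ , f)))  = inj₂ (far⇒part≡ f)
        ... | inj₂ (inj₂ (inj₂ (f , _)))  = inj₁ (far⇒part≡ f)

        from′ : Dec (z ≡ x) → Dec (z ≡ y) → part z ≡ part x ⊎ part z ≡ part y → OnLine d x y z
        from′ (yes z≡x) _ _ = inj₂ (inj₁ z≡x)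
        from′ (no _) (yes z≡y) _ = inj₂ (inj₂ (inj₂ (inj₁ z≡y)))
        from′ {z} (no z≢x) (no _) (inj₁ zx) = adj-on⁺ space {x} {y} {z} (adj ≢)
          (inj₂ (far z≢x zx , adj (λ zy → ≢ (trans (sym zx) zy))))
        from′ {z} (no _) (no z≢y) (inj₂ zy) = adj-on⁺ space {x} {y} {z} (adj ≢)
          (inj₁ (adj (λ zx → ≢ (trans (sym zx) zy)) , far z≢y zy))

        from : part z ≡ part x ⊎ part z ≡ part y → OnLine d x y z
        from {z} = from′ (z ≟ x) (z ≟ y)

      part<p : ∀ z → part z < p
      part<p z = s≤s (/-monoˡ-≤ s (<⇒≤ (toℕ<n z)))

      inside∈ : x ≢ y → part x ≡ part y → toℕ x % s < toℕ y % s → line d x y ∈ candidates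
      inside∈ {x} {y} x≢y eq r<r′ = subst (_∈ candidates) (sym (line-inside x≢y eq))
        (∈-++⁺ˡ (∈-map⁺ insideLine (∈-cartesianProduct⁺ (∈-upTo⁺ (part<p x))
          (∈-orderedPairs s r<r′ (m%n<n (toℕ y) s)))))

      across∈ : part x < part y → line d x y ∈ candidates
      across∈ {x} {y} q<q′ = subst (_∈ candidates) (sym (line-across (<⇒≢ q<q′)))
        (∈-++⁺ʳ (map insideLine (cartesianProduct (upTo p) (orderedPairs s)))
          (∈-map⁺ acrossLine (∈-orderedPairs p q<q′ (part<p y))))

      line∈ : ∀ x y → x ≢ y → line d x y ∈ candidates
      line∈ x y x≢y with <-cmp (part x) (part y)
      ... | tri< q<q′ _ _ = across∈ q<q′
      ... | tri> _ _ q′<q = subst (_∈ candidates) (line-swap space y x) (across∈ q′<q)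
      ... | tri≈ _ eq _ with <-cmp (toℕ x % s) (toℕ y % s)
      ...   | tri< r<r′ _ _ = inside∈ x≢y eq r<r′
      ...   | tri> _ _ r′<r = subst (_∈ candidates) (line-swap space y x)
        (inside∈ (≢-sym x≢y) (sym eq) r′<r)
      ...   | tri≈ _ eq′ _ = contradiction (toℕ-injective (trans (m≡m%n+[m/n]*n (toℕ x) s)
        (trans (cong₂ (λ r q → r + q * s) eq′ eq) (sym (m≡m%n+[m/n]*n (toℕ y) s))))) x≢y

    numLines≤ : numLines space ≤ p * length (orderedPairs s) + length (orderedPairs p)
    numLines≤ = subst (numLines space ≤_) length-candidates
      (injective⇒length≤ _≟ᴸ_ id (deduplicate-! _≟ᴸ_ (lines d)) member (λ _ _ → sym))
      where
      member : ∀ {L} → L ∈ ℒ space → L ∈ candidates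
      member L∈ with ∈-map⁻ (uncurry (line d)) (∈-deduplicate⁻ _≟ᴸ_ (lines d) L∈)
      ... | (x , y) , xy∈ , refl = line∈ x y
        (proj₂ (∈-filter⁻ (λ (u , v) → ¬? (u ≟ v)) {xs = cartesianProduct (allFin n) (allFin n)} xy∈))

      length-candidates : length candidates ≡ p * length (orderedPairs s) + length (orderedPairs p)
      length-candidates = trans (length-++ (map insideLine (cartesianProduct (upTo p) (orderedPairs s))))
        (cong₂ _+_
          (trans (length-map insideLine (cartesianProduct (upTo p) (orderedPairs s)))
            (trans (length-cartesianProduct (upTo p) (orderedPairs s))
              (cong (_* length (orderedPairs s)) (length-upTo p))))
          (length-map acrossLine (orderedPairs p)))

-- Estimates in ℕ

module Arithmetic where

  open import Data.Nat.Base
  open import Data.Nat.Properties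

  cube : ℕ → ℕ
  cube x = x * x * x

  cube-* : ∀ a b → cube (a * b) ≡ cube a * cube b
  cube-* = expand
    where
    expand : ∀ a b → a * b * (a * b) * (a * b) ≡ a * a * a * (b * b * b)
    expand = solve-∀

  cube-mono-≤ : ∀ {a b} → a ≤ b → cube a ≤ cube b
  cube-mono-≤ a≤b = *-mono-≤ (*-mono-≤ a≤b a≤b) a≤b

  cube-cancel-≤ : ∀ {a b} → cube a ≤ cube b → a ≤ b
  cube-cancel-≤ {a} {b} a³≤b³ = ≮⇒≥ λ b<a →
    <⇒≱ (*-mono-< (*-mono-< b<a b<a) b<a) a³≤b³

  2ab≤a²+b² : ∀ a b → 2 * (a * b) ≤ a * a + b * b
  2ab≤a²+b² a b with ≤-total a b
  ... | inj₁ a≤b with c , refl ← m≤n⇒∃[o]m+o≡n a≤b = ≤-trans (m≤m+n _ (c * c)) (≤-reflexive (expand a c))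
    where
    expand : ∀ a c → 2 * (a * (a + c)) + c * c ≡ a * a + (a + c) * (a + c)
    expand = solve-∀
  ... | inj₂ b≤a with c , refl ← m≤n⇒∃[o]m+o≡n b≤a = ≤-trans (m≤m+n _ (c * c)) (≤-reflexive (expand b c))
    where
    expand : ∀ b c → 2 * ((b + c) * b) + c * c ≡ (b + c) * (b + c) + b * b
    expand = solve-∀

  -- The leading term is n² ≤ 8 w N with w² ≤ 2 N. To absorb the lower-order terms a crude bound, N
  -- at least of order n^(4/3), is derived first and then fed back; each correction becomes a
  -- relative error of order 1 / t.
  module _ {n N w t : ℕ} (9≤t : 9 ≤ t) (w²≤ : w * w ≤ 2 * N + 1)
           (r³≤n : cube (t + 7) ≤ n) (n²≤ : n * n ≤ 8 * ((w + 3) * (n + N))) where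

    private
      open ≤-Reasoning

      r y X : ℕ
      r = t + 7
      y = w + 3
      X = n + N

      1≤r : 1 ≤ r
      1≤r = ≤-trans (s≤s z≤n) (m≤n+m 7 t)

      16≤r : 16 ≤ r
      16≤r = +-monoˡ-≤ 7 9≤t

      n⁴≤ : (n * n) * (n * n) ≤ 64 * ((y * y) * (X * X))
      n⁴≤ = ≤-trans (*-mono-≤ n²≤ n²≤) (≤-reflexive (square y X))
        where
        square : ∀ y X → (8 * (y * X)) * (8 * (y * X)) ≡ 64 * ((y * y) * (X * X))
        square = solve-∀

      5≤n : 5 ≤ n
      5≤n = ≤-trans (m≤n+m 5 11) (≤-trans 16≤r (≤-trans (m≤m*n r (r * r) {{m*n≢0 r r {{≢r}} {{≢r}}}})
        (≤-trans (≤-reflexive (sym (*-assoc r r r))) r³≤n)))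
        where
        ≢r : NonZero r
        ≢r = >-nonZero 1≤r

      y²≤4X : y * y ≤ 4 * X
      y²≤4X = begin
        (w + 3) * (w + 3)             ≡⟨ expand w ⟩
        w * w + 2 * (w * 3) + 9       ≤⟨ +-monoˡ-≤ 9 (+-monoʳ-≤ (w * w) (2ab≤a²+b² w 3)) ⟩
        w * w + (w * w + 9) + 9       ≤⟨ +-monoˡ-≤ 9 (+-mono-≤ w²≤ (+-monoˡ-≤ 9 w²≤)) ⟩
        2 * N + 1 + (2 * N + 1 + 9) + 9 ≡⟨ collect N ⟩
        4 * 5 + 4 * N                 ≤⟨ +-monoˡ-≤ (4 * N) (*-monoʳ-≤ 4 5≤n) ⟩
        4 * n + 4 * N                 ≡⟨ *-distribˡ-+ 4 n N ⟨
        4 * X ∎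
        where
        expand : ∀ w → (w + 3) * (w + 3) ≡ w * w + 2 * (w * 3) + 9
        expand = solve-∀
        collect : ∀ N → 2 * N + 1 + (2 * N + 1 + 9) + 9 ≡ 4 * 5 + 4 * N
        collect = solve-∀

      nr≤7X : n * r ≤ 7 * X
      nr≤7X = cube-cancel-≤ (begin
        cube (n * r)                       ≡⟨ cube-* n r ⟩
        cube n * cube r                    ≤⟨ *-monoʳ-≤ (cube n) r³≤n ⟩
        n * n * n * n                      ≡⟨ *-assoc (n * n) n n ⟩
        (n * n) * (n * n)                  ≤⟨ n⁴≤ ⟩
        64 * ((y * y) * (X * X))           ≤⟨ *-monoʳ-≤ 64 (*-monoˡ-≤ (X * X) y²≤4X) ⟩
        64 * ((4 * X) * (X * X))           ≡⟨ collect X ⟩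
        -- 343 = 7³ is the least cube above 256. The resulting 7 is also the offset between `t` and
        -- `r`: removing 7 n from both sides of `nr≤7X` leaves `nt≤7N`.
        256 * cube X                       ≤⟨ *-monoˡ-≤ (cube X) (m≤m+n 256 87) ⟩
        343 * cube X                       ≡⟨ cube-* 7 X ⟨
        cube (7 * X) ∎)
        where
        collect : ∀ X → 64 * ((4 * X) * (X * X)) ≡ 256 * (X * X * X)
        collect = solve-∀

      nt≤7N : n * t ≤ 7 * N
      nt≤7N = +-cancelˡ-≤ (7 * n) _ _ (begin
        7 * n + n * t   ≡⟨ regroup n t ⟩
        n * (t + 7)     ≤⟨ nr≤7X ⟩
        7 * X           ≡⟨ *-distribˡ-+ 7 n N ⟩
        7 * n + 7 * N ∎)
        where
        regroup : ∀ n t → 7 * n + n * t ≡ n * (t + 7)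
        regroup = solve-∀

      Xt≤Nr : X * t ≤ N * r
      Xt≤Nr = begin
        (n + N) * t     ≡⟨ *-distribʳ-+ t n N ⟩
        n * t + N * t   ≤⟨ +-monoˡ-≤ (N * t) nt≤7N ⟩
        7 * N + N * t   ≡⟨ regroup N t ⟩
        N * (t + 7) ∎
        where
        regroup : ∀ N t → 7 * N + N * t ≡ N * (t + 7)
        regroup = solve-∀

      small : (r + 1) * (9 * r + 1) ≤ 2 * N
      small = *-cancelˡ-≤ 7 (begin
        7 * ((r + 1) * (9 * r + 1))        ≡⟨ expand r ⟩
        63 * (r * r) + 70 * r + 7          ≤⟨ +-mono-≤ (+-monoʳ-≤ (63 * (r * r)) (*-monoʳ-≤ 70 (m≤m*n r r {{>-nonZero 1≤r}})))
                                                (*-monoʳ-≤ 7 (*-mono-≤ 1≤r 1≤r)) ⟩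
        63 * (r * r) + 70 * (r * r) + 7 * (r * r)
                                           ≡⟨ collect (r * r) ⟩
        140 * (r * r)                      ≤⟨ *-monoˡ-≤ (r * r) (≤-trans (m≤m+n 140 148) (*-monoʳ-≤ 18 16≤r)) ⟩
        18 * r * (r * r)                   ≡⟨ regroup r ⟩
        2 * (cube r * 9)                   ≤⟨ *-monoʳ-≤ 2 (*-mono-≤ r³≤n 9≤t) ⟩
        2 * (n * t)                        ≤⟨ *-monoʳ-≤ 2 nt≤7N ⟩
        2 * (7 * N)                        ≡⟨ flip N ⟩
        7 * (2 * N) ∎)
        where
        expand : ∀ r → 7 * ((r + 1) * (9 * r + 1)) ≡ 63 * (r * r) + 70 * r + 7
        expand = solve-∀
        collect : ∀ z → 63 * z + 70 * z + 7 * z ≡ 140 * z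
        collect = solve-∀
        regroup : ∀ r → 18 * r * (r * r) ≡ 2 * (r * r * r * 9)
        regroup = solve-∀
        flip : ∀ N → 2 * (7 * N) ≡ 7 * (2 * N)
        flip = solve-∀

      ry²≤ : r * (y * y) ≤ 2 * N * (r + 2)
      ry²≤ = begin
        r * ((w + 3) * (w + 3))
          ≡⟨ expand r w ⟩
        r * (w * w) + 2 * (w * (3 * r)) + 9 * r
          -- The cross term 6 w r is traded for one more w², a share of only 1 / r of the main term,
          -- and for 9 r², which `small` later pays with 2 N.
          ≤⟨ +-monoˡ-≤ (9 * r) (+-monoʳ-≤ (r * (w * w)) (2ab≤a²+b² w (3 * r))) ⟩
        r * (w * w) + (w * w + (3 * r) * (3 * r)) + 9 * r
          ≡⟨ collect r (w * w) ⟩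
        (r + 1) * (w * w) + (9 * (r * r) + 9 * r)
          ≤⟨ +-monoˡ-≤ _ (*-monoʳ-≤ (r + 1) w²≤) ⟩
        (r + 1) * (2 * N + 1) + (9 * (r * r) + 9 * r)
          ≡⟨ regroup r N ⟩
        2 * N * (r + 1) + (r + 1) * (9 * r + 1)
          ≤⟨ +-monoʳ-≤ (2 * N * (r + 1)) small ⟩
        2 * N * (r + 1) + 2 * N
          ≡⟨ finish r N ⟩
        2 * N * (r + 2) ∎
        where
        expand : ∀ r w → r * ((w + 3) * (w + 3)) ≡ r * (w * w) + 2 * (w * (3 * r)) + 9 * r
        expand = solve-∀
        collect : ∀ r z → r * z + (z + (3 * r) * (3 * r)) + 9 * r ≡ (r + 1) * z + (9 * (r * r) + 9 * r)
        collect = solve-∀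
        regroup : ∀ r N → (r + 1) * (2 * N + 1) + (9 * (r * r) + 9 * r) ≡
                          2 * N * (r + 1) + (r + 1) * (9 * r + 1)
        regroup = solve-∀
        finish : ∀ r N → 2 * N * (r + 1) + 2 * N ≡ 2 * N * (r + 2)
        finish = solve-∀

    -- Two of the three factors `t` convert X² by `Xt≤Nr`, and the third is rounded up. The factor
    -- `r` makes room for `ry²≤`, whose r + 2 = t + 9 is the origin of the 9; and 128 is 64 · 2.
    lower-arithmetic : cube t * ((n * n) * (n * n)) ≤ 128 * (cube N * cube (t + 9))
    lower-arithmetic = *-cancelˡ-≤ r {{>-nonZero 1≤r}} (begin
      r * (cube t * ((n * n) * (n * n)))
        ≤⟨ *-monoʳ-≤ r (*-monoʳ-≤ (cube t) n⁴≤) ⟩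
      r * (cube t * (64 * ((y * y) * (X * X))))
        ≡⟨ regroup r t y X ⟩
      64 * ((r * (y * y)) * ((X * t) * (X * t))) * t
        ≤⟨ *-mono-≤ (*-monoʳ-≤ 64 (*-mono-≤ ry²≤ (*-mono-≤ Xt≤Nr Xt≤Nr))) (m≤m+n t 9) ⟩
      64 * ((2 * N * (r + 2)) * ((N * r) * (N * r))) * (t + 9)
        ≡⟨ collect N r (r + 2) (t + 9) ⟩
      r * (128 * (cube N * ((r + 2) * r * (t + 9))))
        ≡⟨ cong (λ z → r * (128 * (cube N * (z * r * (t + 9))))) (+-assoc t 7 2) ⟩
      r * (128 * (cube N * ((t + 9) * r * (t + 9))))
        ≤⟨ *-monoʳ-≤ r (*-monoʳ-≤ 128 (*-monoʳ-≤ (cube N)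
             (*-monoˡ-≤ (t + 9) (*-monoʳ-≤ (t + 9) (+-monoʳ-≤ t (m≤m+n 7 2)))))) ⟩
      r * (128 * (cube N * cube (t + 9))) ∎)
      where
      regroup : ∀ r t y X → r * (t * t * t * (64 * ((y * y) * (X * X)))) ≡
                            64 * ((r * (y * y)) * ((X * t) * (X * t))) * t
      regroup = solve-∀
      collect : ∀ N r a b → 64 * ((2 * N * a) * ((N * r) * (N * r))) * b ≡
                            r * (128 * (N * N * N * (a * r * b)))
      collect = solve-∀

  module _ {n N s p C D : ℕ} (2≤s : 2 ≤ s) (s³≤2n : cube s ≤ 2 * n)
           (2n≤ : 2 * n ≤ cube (s + 1)) (ps≤ : p * s ≤ n + s)
           (2C≤ : 2 * C ≤ s * s) (2D≤ : 2 * D ≤ p * p) (N≤ : N ≤ p * C + D) where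

    private
      open ≤-Reasoning

      Y u v : ℕ
      Y = n + s
      u = s + 1
      v = s + 15

      s≢0 : NonZero s
      s≢0 = >-nonZero (≤-trans (s≤s z≤n) 2≤s)

      s²≤n : s * s ≤ n
      s²≤n = *-cancelˡ-≤ 2 (begin
        2 * (s * s)  ≤⟨ *-monoˡ-≤ (s * s) 2≤s ⟩
        s * (s * s)  ≡⟨ *-assoc s s s ⟨
        cube s       ≤⟨ s³≤2n ⟩
        2 * n ∎)

      Ys≤nu : Y * s ≤ n * u
      Ys≤nu = begin
        (n + s) * s     ≡⟨ *-distribʳ-+ s n s ⟩
        n * s + s * s   ≤⟨ +-monoʳ-≤ (n * s) s²≤n ⟩
        n * s + n       ≡⟨ collect n s ⟩
        n * (s + 1) ∎
        where
        collect : ∀ n s → n * s + n ≡ n * (s + 1)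
        collect = solve-∀

      -- The lines of far pairs contribute 2 Y², by `s³≤2n`, and those of adjacent pairs Y²;
      -- together this is the 3 in β.
      2Ns²≤3Y² : 2 * N * (s * s) ≤ 3 * (Y * Y)
      2Ns²≤3Y² = begin
        2 * N * (s * s)
          ≤⟨ *-monoˡ-≤ (s * s) (*-monoʳ-≤ 2 N≤) ⟩
        2 * (p * C + D) * (s * s)
          ≡⟨ regroup p C D s ⟩
        (p * (2 * C) + 2 * D) * (s * s)
          ≤⟨ *-monoˡ-≤ (s * s) (+-mono-≤ (*-monoʳ-≤ p 2C≤) 2D≤) ⟩
        (p * (s * s) + p * p) * (s * s)
          ≡⟨ regroup′ p s ⟩
        (p * s) * cube s + (p * s) * (p * s)
          ≤⟨ +-mono-≤ (*-mono-≤ ps≤ (≤-trans s³≤2n (*-monoʳ-≤ 2 (m≤m+n n s)))) (*-mono-≤ ps≤ ps≤) ⟩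
        Y * (2 * Y) + Y * Y
          ≡⟨ collect Y ⟩
        3 * (Y * Y) ∎
        where
        regroup : ∀ p C D s → 2 * (p * C + D) * (s * s) ≡ (p * (2 * C) + 2 * D) * (s * s)
        regroup = solve-∀
        regroup′ : ∀ p s → (p * (s * s) + p * p) * (s * s) ≡ (p * s) * (s * s * s) + (p * s) * (p * s)
        regroup′ = solve-∀
        collect : ∀ Y → Y * (2 * Y) + Y * Y ≡ 3 * (Y * Y)
        collect = solve-∀

      2Ns⁴≤3n²u² : 2 * N * (s * cube s) ≤ 3 * (n * n * (u * u))
      2Ns⁴≤3n²u² = begin
        2 * N * (s * cube s)        ≡⟨ regroup N s ⟩
        2 * N * (s * s) * (s * s)   ≤⟨ *-monoˡ-≤ (s * s) 2Ns²≤3Y² ⟩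
        3 * (Y * Y) * (s * s)       ≡⟨ regroup′ Y s ⟩
        3 * ((Y * s) * (Y * s))     ≤⟨ *-monoʳ-≤ 3 (*-mono-≤ Ys≤nu Ys≤nu) ⟩
        3 * ((n * u) * (n * u))     ≡⟨ regroup″ n u ⟩
        3 * (n * n * (u * u)) ∎
        where
        regroup : ∀ N s → 2 * N * (s * (s * s * s)) ≡ 2 * N * (s * s) * (s * s)
        regroup = solve-∀
        regroup′ : ∀ Y s → 3 * (Y * Y) * (s * s) ≡ 3 * ((Y * s) * (Y * s))
        regroup′ = solve-∀
        regroup″ : ∀ n u → 3 * ((n * u) * (n * u)) ≡ 3 * (n * n * (u * u))
        regroup″ = solve-∀

      -- The 15 is 4 + 6 + 4 + 1, the lower binomial coefficients, with every lower power of `s`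
      -- rounded up to s³.
      u⁴≤s³v : u * cube u ≤ cube s * v
      u⁴≤s³v = begin
        (s + 1) * ((s + 1) * (s + 1) * (s + 1))
          ≡⟨ expand s ⟩
        s * cube s + (4 * cube s + 6 * (s * s) + 4 * s + 1)
          ≤⟨ +-monoʳ-≤ (s * cube s) (+-mono-≤ (+-mono-≤ (+-monoʳ-≤ (4 * cube s)
               (*-monoʳ-≤ 6 (m≤m*n (s * s) s))) (*-monoʳ-≤ 4 s≤s³)) 1≤s³) ⟩
        s * cube s + (4 * cube s + 6 * cube s + 4 * cube s + cube s)
          ≡⟨ collect s (cube s) ⟩
        cube s * (s + 15) ∎
        where
        instance _ = s≢0
        s≤s³ : s ≤ cube s
        s≤s³ = ≤-trans (m≤m*n s s) (m≤m*n (s * s) s)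
        1≤s³ : 1 ≤ cube s
        1≤s³ = ≤-trans (≤-trans (s≤s z≤n) 2≤s) s≤s³
        expand : ∀ s → (s + 1) * ((s + 1) * (s + 1) * (s + 1)) ≡
                       s * (s * s * s) + (4 * (s * s * s) + 6 * (s * s) + 4 * s + 1)
        expand = solve-∀
        collect : ∀ s z → s * z + (4 * z + 6 * z + 4 * z + z) ≡ z * (s + 15)
        collect = solve-∀

    -- The auxiliary factor n² s⁹ turns the left side into (2 n)² (2 N s⁴)³. There 2 n ≤ u³
    -- contributes u⁶ and the bound on N another u⁶, and u¹² is the cube of u⁴.
    upper-arithmetic : 32 * (cube N * cube s) ≤ 27 * ((n * n) * (n * n)) * cube (s + 15)
    upper-arithmetic = *-cancelʳ-≤ _ _ (n * n * cube (cube s)) {{m*n≢0 (n * n) _ {{n²≢0}} {{s⁹≢0}}}} (begin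
      32 * (cube N * cube s) * (n * n * cube (cube s))
        ≡⟨ regroup N s (cube s) n ⟩
      (2 * n) * (2 * n) * cube (2 * N * (s * cube s))
        ≤⟨ *-mono-≤ (*-mono-≤ 2n≤ 2n≤) (cube-mono-≤ 2Ns⁴≤3n²u²) ⟩
      cube u * cube u * cube (3 * (n * n * (u * u)))
        ≡⟨ regroup′ u n ⟩
      27 * (n * n * (n * n) * (n * n)) * cube (u * cube u)
        ≤⟨ *-monoʳ-≤ (27 * (n * n * (n * n) * (n * n))) (cube-mono-≤ u⁴≤s³v) ⟩
      27 * (n * n * (n * n) * (n * n)) * cube (cube s * v)
        ≡⟨ regroup″ n (cube s) v ⟩
      27 * ((n * n) * (n * n)) * cube v * (n * n * cube (cube s)) ∎)
      where
      n≢0 : NonZero n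
      n≢0 = >-nonZero (≤-trans (*-mono-≤ {1} {s} {1} {s} 1≤s 1≤s) s²≤n)
        where
        1≤s : 1 ≤ s
        1≤s = ≤-trans (s≤s z≤n) 2≤s
      n²≢0 : NonZero (n * n)
      n²≢0 = m*n≢0 n n {{n≢0}} {{n≢0}}
      cube≢0 : ∀ z → NonZero z → NonZero (cube z)
      cube≢0 z z≢0 = m*n≢0 (z * z) z {{m*n≢0 z z {{z≢0}} {{z≢0}}}} {{z≢0}}
      s⁹≢0 : NonZero (cube (cube s))
      s⁹≢0 = cube≢0 (cube s) (cube≢0 s s≢0)
      regroup : ∀ N s σ n → 32 * (N * N * N * (s * s * s)) * (n * n * (σ * σ * σ)) ≡
        (2 * n) * (2 * n) * (2 * N * (s * σ) * (2 * N * (s * σ)) * (2 * N * (s * σ)))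
      regroup = solve-∀
      regroup′ : ∀ u n → u * u * u * (u * u * u) *
        (3 * (n * n * (u * u)) * (3 * (n * n * (u * u))) * (3 * (n * n * (u * u)))) ≡
        27 * (n * n * (n * n) * (n * n)) *
        (u * (u * u * u) * (u * (u * u * u)) * (u * (u * u * u)))
      regroup′ = solve-∀
      regroup″ : ∀ n σ v → 27 * (n * n * (n * n) * (n * n)) * (σ * v * (σ * v) * (σ * v)) ≡
        27 * ((n * n) * (n * n)) * (v * v * v) * (n * n * (σ * σ * σ))
      regroup″ = solve-∀

  ^3≡cube : ∀ k → k ^ 3 ≡ cube k
  ^3≡cube = expand
    where
    expand : ∀ k → k * (k * (k * 1)) ≡ k * k * k
    expand = solve-∀

  ^4≡ : ∀ k → k ^ 4 ≡ (k * k) * (k * k)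
  ^4≡ = expand
    where
    expand : ∀ k → k * (k * (k * (k * 1))) ≡ (k * k) * (k * k)
    expand = solve-∀

  ^2≡ : ∀ k → k ^ 2 ≡ k * k
  ^2≡ k = cong (k *_) (*-identityʳ k)

  -- From inequalities between cubes to truncated cube roots.

  module Truncation where

    open ≤-Reasoning

    -- Here a / M and b / M are the truncations of 2^(-7/3) and n^(4/3); after cubing, no root is
    -- left.
    truncated-lower : ∀ {n N t q a b M} → cube t * (n ^ 4) ≤ 128 * (cube N * cube q) →
      a ^ 3 * 2 ^ 7 ≤ 1 * M ^ 3 → b ^ 3 * 1 ≤ n ^ 4 * M ^ 3 →
      t * a * b ≤ N * (q * M * M)
    truncated-lower {n} {N} {t} {q} {a} {b} {M} bound a≤ b≤ =
      cube-cancel-≤ (*-cancelˡ-≤ 128 (begin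
        128 * cube (t * a * b)
          ≡⟨ regroup t a b ⟩
        cube t * (a ^ 3 * 2 ^ 7 * (b ^ 3 * 1))
          ≤⟨ *-monoʳ-≤ (cube t) (*-mono-≤ a≤ b≤) ⟩
        cube t * (1 * M ^ 3 * (n ^ 4 * M ^ 3))
          ≡⟨ regroup′ (cube t) (n ^ 4) (M ^ 3) ⟩
        cube t * n ^ 4 * (M ^ 3 * M ^ 3)
          ≤⟨ *-monoˡ-≤ (M ^ 3 * M ^ 3) bound ⟩
        128 * (cube N * cube q) * (M ^ 3 * M ^ 3)
          ≡⟨ regroup″ N q M ⟩
        128 * cube (N * (q * M * M)) ∎))
      where
      regroup : ∀ t a b → 128 * (t * a * b * (t * a * b) * (t * a * b)) ≡
        t * t * t * (a * (a * (a * 1)) * 128 * (b * (b * (b * 1)) * 1))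
      regroup = solve-∀
      regroup′ : ∀ t n M → t * (1 * M * (n * M)) ≡ t * n * (M * M)
      regroup′ = solve-∀
      regroup″ : ∀ N q M → 128 * (N * N * N * (q * q * q)) *
        (M * (M * (M * 1)) * (M * (M * (M * 1)))) ≡
        128 * (N * (q * M * M) * (N * (q * M * M)) * (N * (q * M * M)))
      regroup″ = solve-∀

    -- Truncation rounds down, so an upper bound has to use the successors. The factor `1 * M`
    -- mirrors the denominator that arises from multiplying by `fromℕ 3`.
    truncated-upper : ∀ {n N s v a b M} → 32 * (cube N * cube s) ≤ 27 * n ^ 4 * cube v →
      1 * M ^ 3 ≤ suc a ^ 3 * 2 ^ 5 → n ^ 4 * M ^ 3 ≤ suc b ^ 3 * 1 →
      N * (s * (1 * M) * M) ≤ v * (3 * suc a) * suc b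
    truncated-upper {n} {N} {s} {v} {a} {b} {M} bound a> b> =
      cube-cancel-≤ (*-cancelˡ-≤ 32 (begin
        32 * cube (N * (s * (1 * M) * M))
          ≡⟨ regroup N s M ⟩
        32 * (cube N * cube s) * (M ^ 3 * M ^ 3)
          ≤⟨ *-monoˡ-≤ (M ^ 3 * M ^ 3) bound ⟩
        27 * n ^ 4 * cube v * (M ^ 3 * M ^ 3)
          ≡⟨ regroup′ (n ^ 4) (cube v) (M ^ 3) ⟩
        27 * cube v * (1 * M ^ 3 * (n ^ 4 * M ^ 3))
          ≤⟨ *-monoʳ-≤ (27 * cube v) (*-mono-≤ a> b>) ⟩
        27 * cube v * (suc a ^ 3 * 2 ^ 5 * (suc b ^ 3 * 1))
          ≡⟨ regroup″ v (suc a) (suc b) ⟩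
        32 * cube (v * (3 * suc a) * suc b) ∎))
      where
      regroup : ∀ N s M → 32 * (N * (s * (1 * M) * M) * (N * (s * (1 * M) * M)) * (N * (s * (1 * M) * M))) ≡
        32 * (N * N * N * (s * s * s)) * (M * (M * (M * 1)) * (M * (M * (M * 1))))
      regroup = solve-∀
      regroup′ : ∀ n v M → 27 * n * v * (M * M) ≡ 27 * v * (1 * M * (n * M))
      regroup′ = solve-∀
      regroup″ : ∀ v a b → 27 * (v * v * v) * (a * (a * (a * 1)) * 32 * (b * (b * (b * 1)) * 1)) ≡
        32 * (v * (3 * a) * b * (v * (3 * a) * b) * (v * (3 * a) * b))
      regroup″ = solve-∀

    -- Replacing (a + 1)(b + 1) by a b costs a + b + 1, which is at most (n² + 2) M. Relative to M²
    -- this vanishes as M grows with n fixed.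
    truncation-error : ∀ {n s v a b M} → 1 ≤ n → 1 ≤ s → 1 ≤ M →
      a ^ 3 * 2 ^ 5 ≤ 1 * M ^ 3 → b ^ 3 * 1 ≤ n ^ 4 * M ^ 3 →
      3 * v * (a + b + 1) * M ≤ 3 * v * (n * n + 2) * (s * (1 * M) * M)
    truncation-error {n} {s} {v} {a} {b} {M} 1≤n 1≤s 1≤M a≤ b≤ = begin
      3 * v * (a + b + 1) * M
        ≤⟨ *-monoˡ-≤ M (*-monoʳ-≤ (3 * v) (+-mono-≤ (+-mono-≤ a≤M b≤n²M) 1≤M)) ⟩
      3 * v * (M + n * n * M + M) * M
        ≡⟨ regroup v n M ⟩
      3 * v * (n * n + 2) * (1 * (1 * M) * M)
        ≤⟨ *-monoʳ-≤ (3 * v * (n * n + 2)) (*-monoˡ-≤ M (*-monoˡ-≤ (1 * M) 1≤s)) ⟩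
      3 * v * (n * n + 2) * (s * (1 * M) * M) ∎
      where
      a≤M : a ≤ M
      a≤M = cube-cancel-≤ (begin
        cube a           ≡⟨ ^3≡cube a ⟨
        a ^ 3            ≤⟨ m≤m*n (a ^ 3) (2 ^ 5) ⟩
        a ^ 3 * 2 ^ 5    ≤⟨ a≤ ⟩
        1 * M ^ 3        ≡⟨ *-identityˡ (M ^ 3) ⟩
        M ^ 3            ≡⟨ ^3≡cube M ⟩
        cube M ∎)
      b≤n²M : b ≤ n * n * M
      b≤n²M = cube-cancel-≤ (begin
        cube b                          ≡⟨ ^3≡cube b ⟨
        b ^ 3                           ≡⟨ *-identityʳ (b ^ 3) ⟨
        b ^ 3 * 1                       ≤⟨ b≤ ⟩
        n ^ 4 * M ^ 3                   ≡⟨ cong₂ _*_ (^4≡ n) (^3≡cube M) ⟩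
        n * n * (n * n) * cube M        ≤⟨ *-monoˡ-≤ (cube M) (m≤m*n (n * n * (n * n)) (n * n)
                                             {{>-nonZero (*-mono-≤ 1≤n 1≤n)}}) ⟩
        cube (n * n) * cube M           ≡⟨ cube-* (n * n) M ⟨
        cube (n * n * M) ∎)
      regroup : ∀ v n M → 3 * v * (M + n * n * M + M) * M ≡ 3 * v * (n * n + 2) * (1 * (1 * M) * M)
      regroup = solve-∀

-- The two bounds on `h` as inequalities between natural numbers.

module Extremal where

  open import Data.Nat.Base
  open import Data.Nat.Properties
  open import Data.Nat.DivMod using (_/_; m/n*n≤m)
  open Arithmetic
  open Lines using (quadratic-bound)
  open PartiteLines

  cbrt : ℕ → ℕ
  cbrt num = rootFloor 3 num 1 1

  cube-cbrt≤ : ∀ num → cube (cbrt num) ≤ num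
  cube-cbrt≤ num = subst₂ _≤_
    (trans (*-identityʳ _) (^3≡cube (cbrt num))) (*-identityʳ num) (rootFloor-≤ 3 num 1 1)

  cbrt-max : ∀ num k → cube k ≤ num → k ≤ cbrt num
  cbrt-max num k k³≤ = rootFloor-max 3 num 1 1 k (subst₂ _≤_
    (trans (sym (^3≡cube k)) (sym (*-identityʳ _))) (sym (*-identityʳ num)) k³≤)

  <cube-cbrt : ∀ num → num < cube (suc (cbrt num))
  <cube-cbrt num = ≰⇒> λ k³≤ → 1+n≰n (cbrt-max num (suc (cbrt num)) k³≤)

  lower-bound : ∀ n N t → 9 ≤ t → cube (t + 7) ≤ n →
                (∀ m → (∀ k → k * k ≤ 2 * (k + N) → k ≤ m) → n * n ≤ 8 * ((m + 2) * (n + N))) →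
                cube t * ((n * n) * (n * n)) ≤ 128 * (cube N * cube (t + 9))
  lower-bound n N t 9≤t r³≤n quadratic = lower-arithmetic {n} {N} {w} {t} 9≤t w²≤ r³≤n
    (subst (λ z → n * n ≤ 8 * (z * (n + N))) (+-assoc w 1 2) (quadratic (w + 1) small))
    where
    w : ℕ
    w = rootFloor 2 (2 * N + 1) 1 1

    w²≤ : w * w ≤ 2 * N + 1
    w²≤ = subst₂ _≤_ (trans (*-identityʳ _) (^2≡ w)) (*-identityʳ _)
      (rootFloor-≤ 2 (2 * N + 1) 1 1)

    -- For k = j + 1 the hypothesis reads j² ≤ 2 N + 1. So w + 1 is an admissible `m`, and m + 2
    -- becomes the w + 3 of the arithmetic.
    small : ∀ k → k * k ≤ 2 * (k + N) → k ≤ w + 1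
    small zero    _   = z≤n
    small (suc j) k²≤ = subst (suc j ≤_) (+-comm 1 w) (s≤s
      (rootFloor-max 2 (2 * N + 1) 1 1 j (subst₂ _≤_
        (trans (sym (^2≡ j)) (sym (*-identityʳ _))) (sym (*-identityʳ _))
        (+-cancelˡ-≤ (2 * j + 1) _ _
          (subst₂ _≤_ (expand j) (regroup j N) k²≤)))))
      where
      expand : ∀ j → (1 + j) * (1 + j) ≡ 2 * j + 1 + j * j
      expand = solve-∀
      regroup : ∀ j N → 2 * (1 + j + N) ≡ 2 * j + 1 + (2 * N + 1)
      regroup = solve-∀

  h-attained : ∀ n → ∃[ S ] numLines {n} S ≡ h n
  h-attained n = proj₁ (proj₂ (minNumLines n))

  h-least : ∀ {n} (S : Space₁₂ n) → h n ≤ numLines S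
  h-least {n} = proj₂ (proj₂ (minNumLines n))

  h-lower : ∀ n t → 9 ≤ t → cube (t + 7) ≤ n →
            cube t * ((n * n) * (n * n)) ≤ 128 * (cube (h n) * cube (t + 9))
  h-lower n t 9≤t r³≤n = subst (λ N → cube t * ((n * n) * (n * n)) ≤ 128 * (cube N * cube (t + 9)))
    (proj₂ (h-attained n))
    (lower-bound n _ t 9≤t r³≤n (quadratic-bound (proj₁ (h-attained n))))

  h-upper : ∀ n s → 2 ≤ s → cube s ≤ 2 * n → 2 * n ≤ cube (s + 1) →
            32 * (cube (h n) * cube s) ≤ 27 * ((n * n) * (n * n)) * cube (s + 15)
  h-upper n s@(suc _) 2≤s s³≤2n 2n≤ = upper-arithmetic {n} {h n} {s} {p}
    {length (orderedPairs s)} {length (orderedPairs p)} 2≤s s³≤2n 2n≤ ps≤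
    (length-orderedPairs s) (length-orderedPairs p)
    (≤-trans (h-least space) numLines≤)
    where
    open Multipartite n s
    p : ℕ
    p = suc (n / s)

    ps≤ : p * s ≤ n + s
    ps≤ = subst (p * s ≤_) (+-comm s n) (+-monoʳ-≤ s (m/n*n≤m n s))

-- Real estimates

open import Data.Integer.Base as ℤ using (+_; -[1+_])
import Data.Integer.Properties as ℤ
open import Data.Rational.Unnormalised.Base as ℚ using (ℚᵘ; mkℚᵘ; _/_; 0ℚᵘ; 1ℚᵘ; *≡*; *≤*)
import Data.Rational.Unnormalised.Properties as ℚ
open import Data.Rational.Unnormalised.Solver using (module +-*-Solver)
open Defs using (_≤_; _+_; _*_; _^_)
open Arithmetic using (cube; ^4≡; module Truncation)
open Extremal

-- The denominator is k + 1, as in mkℚᵘ.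
frac : ℕ → ℕ → ℚᵘ
frac a k = mkℚᵘ (+ a) k

frac-≤ : ∀ {a k b l} → a ℕ.* suc l ℕ.≤ b ℕ.* suc k → frac a k ℚ.≤ frac b l
frac-≤ {a} {k} {b} {l} le = *≤* (subst₂ ℤ._≤_ (ℤ.pos-* a (suc l)) (ℤ.pos-* b (suc k)) (ℤ.+≤+ le))

frac-* : ∀ a k b l → frac a k ℚ.* frac b l ≡ frac (a ℕ.* b) (l ℕ.+ k ℕ.* suc l)
frac-* a k b l = cong (λ z → mkℚᵘ z (l ℕ.+ k ℕ.* suc l)) (sym (ℤ.pos-* a b))

frac-+ : ∀ a b k → frac a k ℚ.+ frac b k ℚ.≃ frac (a ℕ.+ b) k
frac-+ a b k = *≡* (trans
  (cong (ℤ._* + suc k) (sym (ℤ.*-distribʳ-+ (+ suc k) (+ a) (+ b))))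
  (ℤ.*-assoc (+ (a ℕ.+ b)) (+ suc k) (+ suc k)))

frac-vanishes : ∀ c ε → 0ℚᵘ ℚ.< ε → ∃[ K ] ∀ k → K ℕ.≤ k → frac c k ℚ.≤ ε
frac-vanishes c (mkℚᵘ (+ suc e) b) _ = c ℕ.* suc b , λ k K≤k → frac-≤ {c} {k} {suc e} {b}
  (ℕ.≤-trans K≤k (ℕ.≤-trans (ℕ.n≤1+n k) (ℕ.m≤n*m (suc k) (suc e))))
frac-vanishes c (mkℚᵘ (+ zero) b) (ℚ.*<* (ℤ.+<+ ()))
frac-vanishes c (mkℚᵘ -[1+ _ ] b) (ℚ.*<* ())

fromℚ-mono : ∀ {p q} → p ℚ.≤ q → fromℚ p ≤ fromℚ q
fromℚ-mono {p} {q} p≤q ε 0<ε = 0 , λ _ _ →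
  ℚ.≤-trans p≤q (ℚ.p≤p+q q ε {{ℚ.nonNegative (ℚ.<⇒≤ 0<ε)}})

1+[p-1]≃p : ∀ p → (+ 1 / 1) ℚ.+ (p ℚ.- 1ℚᵘ) ℚ.≃ p
1+[p-1]≃p p = solve 1 (λ a → con (+ 1 / 1) :+ (a :- con (+ 1 / 1)) := a) ℚ.≃-refl p
  where open +-*-Solver

Unbounded : (ℕ → ℕ) → Set
Unbounded k = ∀ K → ∃[ N ] ∀ n → N ℕ.≤ n → K ℕ.≤ k n

-- Closeness of `ρ` to 1 is put as two additive inequalities, the form in which equal denominators
-- make it easy to verify.
littleO : ∀ (ρ : ℕ → ℚᵘ) c (k : ℕ → ℕ) → Unbounded k →
          (∃[ N ] ∀ n → N ℕ.≤ n → 1ℚᵘ ℚ.≤ ρ n ℚ.+ frac c (k n) × ρ n ℚ.≤ 1ℚᵘ ℚ.+ frac c (k n)) →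
          IsLittleO1 (λ n → fromℚ (ρ n ℚ.- 1ℚᵘ))
littleO ρ c k unbounded (N₀ , near) ε 0<ε with frac-vanishes c ε 0<ε
... | K , vanish with unbounded K
... | N₁ , K≤k = N₀ ℕ.⊔ N₁ , λ n N≤n →
  let
    η≤ε = vanish (k n) (K≤k n (ℕ.m⊔n≤o⇒n≤o N₀ N₁ N≤n))
    1≤ , ≤1 = near n (ℕ.m⊔n≤o⇒m≤o N₀ N₁ N≤n)
  in
  fromℚ-mono { ℚ.- ε} {ρ n ℚ.- 1ℚᵘ} (begin
    ℚ.- ε                             ≃⟨ solve 1 (λ e → :- e := con 1ℚᵘ :- con 1ℚᵘ :- e) ℚ.≃-refl ε ⟩
    1ℚᵘ ℚ.- 1ℚᵘ ℚ.- ε                 ≤⟨ ℚ.+-monoˡ-≤ (ℚ.- ε) (ℚ.+-monoˡ-≤ (ℚ.- 1ℚᵘ)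
                                           (ℚ.≤-trans 1≤ (ℚ.+-monoʳ-≤ (ρ n) η≤ε))) ⟩
    ρ n ℚ.+ ε ℚ.- 1ℚᵘ ℚ.- ε           ≃⟨ solve 2 (λ r e → r :+ e :- con 1ℚᵘ :- e := r :- con 1ℚᵘ)
                                           ℚ.≃-refl (ρ n) ε ⟩
    ρ n ℚ.- 1ℚᵘ ∎) ,
  fromℚ-mono {ρ n ℚ.- 1ℚᵘ} {ε} (begin
    ρ n ℚ.- 1ℚᵘ                       ≤⟨ ℚ.+-monoˡ-≤ (ℚ.- 1ℚᵘ) (ℚ.≤-trans ≤1 (ℚ.+-monoʳ-≤ 1ℚᵘ η≤ε)) ⟩
    1ℚᵘ ℚ.+ ε ℚ.- 1ℚᵘ                 ≃⟨ solve 1 (λ e → con 1ℚᵘ :+ e :- con 1ℚᵘ := e) ℚ.≃-refl ε ⟩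
    ε ∎)
  where
  open ℚ.≤-Reasoning
  open +-*-Solver

1≃frac : ∀ k → 1ℚᵘ ℚ.≃ frac (suc k) k
1≃frac k = *≡* (ℤ.*-comm (+ 1) (+ suc k))

rational-lower : ∀ {t a b N k m} → t ℕ.* a ℕ.* b ℕ.≤ N ℕ.* (suc k ℕ.* suc m ℕ.* suc m) →
  ((+ 1 / 1) ℚ.+ (frac t k ℚ.- 1ℚᵘ)) ℚ.* frac a m ℚ.* frac b m ℚ.≤ frac N 0
rational-lower {t} {a} {b} {N} {k} {m} le = begin
  ((+ 1 / 1) ℚ.+ (frac t k ℚ.- 1ℚᵘ)) ℚ.* frac a m ℚ.* frac b m
    ≃⟨ ℚ.*-congʳ {frac b m} (ℚ.*-congʳ {frac a m} (1+[p-1]≃p (frac t k))) ⟩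
  frac t k ℚ.* frac a m ℚ.* frac b m
    ≡⟨ cong (ℚ._* frac b m) (frac-* t k a m) ⟩
  frac (t ℕ.* a) (m ℕ.+ k ℕ.* suc m) ℚ.* frac b m
    ≡⟨ frac-* (t ℕ.* a) (m ℕ.+ k ℕ.* suc m) b m ⟩
  frac (t ℕ.* a ℕ.* b) (m ℕ.+ (m ℕ.+ k ℕ.* suc m) ℕ.* suc m)
    ≤⟨ frac-≤ {t ℕ.* a ℕ.* b} {m ℕ.+ (m ℕ.+ k ℕ.* suc m) ℕ.* suc m} {N} {0}
         (subst (ℕ._≤ N ℕ.* (suc k ℕ.* suc m ℕ.* suc m))
           (sym (ℕ.*-identityʳ (t ℕ.* a ℕ.* b))) le) ⟩
  frac N 0 ∎
  where open ℚ.≤-Reasoning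

rational-upper : ∀ {v a b N C σ m ε} →
  N ℕ.* (suc σ ℕ.* (1 ℕ.* suc m) ℕ.* suc m) ℕ.≤ v ℕ.* (3 ℕ.* suc a) ℕ.* suc b →
  3 ℕ.* v ℕ.* (a ℕ.+ b ℕ.+ 1) ℕ.* suc m ℕ.≤ C ℕ.* (suc σ ℕ.* (1 ℕ.* suc m) ℕ.* suc m) →
  frac C m ℚ.≤ ε →
  frac N 0 ℚ.≤
    ((+ 1 / 1) ℚ.+ (frac v σ ℚ.- 1ℚᵘ)) ℚ.* (frac 3 0 ℚ.* frac a m) ℚ.* frac b m ℚ.+ ε
rational-upper {v} {a} {b} {N} {C} {σ} {m} {ε} le error C≤ε = begin
  frac N 0
    ≤⟨ frac-≤ {N} {0} {v ℕ.* (3 ℕ.* suc a) ℕ.* suc b} {D}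
         (subst (N ℕ.* suc D ℕ.≤_) (sym (ℕ.*-identityʳ (v ℕ.* (3 ℕ.* suc a) ℕ.* suc b))) le) ⟩
  frac (v ℕ.* (3 ℕ.* suc a) ℕ.* suc b) D
    ≡⟨ cong (λ z → frac z D) (expand v a b) ⟩
  frac (v ℕ.* (3 ℕ.* a) ℕ.* b ℕ.+ E) D
    ≃⟨ frac-+ (v ℕ.* (3 ℕ.* a) ℕ.* b) E D ⟨
  frac (v ℕ.* (3 ℕ.* a) ℕ.* b) D ℚ.+ frac E D
    ≤⟨ ℚ.+-monoʳ-≤ (frac (v ℕ.* (3 ℕ.* a) ℕ.* b) D)
         (ℚ.≤-trans (frac-≤ {E} {D} {C} {m} error) C≤ε) ⟩
  frac (v ℕ.* (3 ℕ.* a) ℕ.* b) D ℚ.+ ε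
    ≡⟨ cong (ℚ._+ ε) product ⟨
  frac v σ ℚ.* (frac 3 0 ℚ.* frac a m) ℚ.* frac b m ℚ.+ ε
    ≃⟨ ℚ.+-congˡ ε (ℚ.*-congʳ {frac b m} (ℚ.*-congʳ {frac 3 0 ℚ.* frac a m}
         (1+[p-1]≃p (frac v σ)))) ⟨
  ((+ 1 / 1) ℚ.+ (frac v σ ℚ.- 1ℚᵘ)) ℚ.* (frac 3 0 ℚ.* frac a m) ℚ.* frac b m ℚ.+ ε ∎
  where
  open ℚ.≤-Reasoning
  k D E : ℕ
  k = m ℕ.+ 0 ℕ.* suc m
  D = m ℕ.+ (k ℕ.+ σ ℕ.* suc k) ℕ.* suc m
  E = 3 ℕ.* v ℕ.* (a ℕ.+ b ℕ.+ 1)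

  expand : ∀ v a b → v ℕ.* (3 ℕ.* (1 ℕ.+ a)) ℕ.* (1 ℕ.+ b) ≡
                     v ℕ.* (3 ℕ.* a) ℕ.* b ℕ.+ 3 ℕ.* v ℕ.* (a ℕ.+ b ℕ.+ 1)
  expand = solve-∀

  product : frac v σ ℚ.* (frac 3 0 ℚ.* frac a m) ℚ.* frac b m ≡ frac (v ℕ.* (3 ℕ.* a) ℕ.* b) D
  product = trans (cong (λ q → frac v σ ℚ.* q ℚ.* frac b m) (frac-* 3 0 a m))
    (trans (cong (ℚ._* frac b m) (frac-* v σ (3 ℕ.* a) k))
      (frac-* (v ℕ.* (3 ℕ.* a)) (k ℕ.+ σ ℕ.* suc k) b m))

<-rootFloor : ∀ e num den .{{_ : NonZero e}} .{{_ : NonZero den}} M →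
  num ℕ.* M ℕ.^ e ℕ.≤ suc (rootFloor e num den M) ℕ.^ e ℕ.* den
<-rootFloor e num den M = ℕ.≰⇒≥ λ le → ℕ.1+n≰n (rootFloor-max e num den M _ le)

-- With r = cbrt n the lower bound holds with the factor (r - 7) / (r + 2);
-- the truncation at r < 7 only affects small n.
lowerOffset : ℕ → ℕ
lowerOffset n = cbrt n ℕ.∸ 7

lowerRatio : ℕ → ℚᵘ
lowerRatio n = frac (lowerOffset n) (lowerOffset n ℕ.+ 8)

lowerRatio→1 : IsLittleO1 (λ n → fromℚ (lowerRatio n ℚ.- 1ℚᵘ))
lowerRatio→1 = littleO lowerRatio 9 (λ n → lowerOffset n ℕ.+ 8) unbounded
  (0 , λ n _ → near (lowerOffset n))
  where
  unbounded : Unbounded (λ n → lowerOffset n ℕ.+ 8)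
  unbounded K = cube (K ℕ.+ 7) , λ n N≤n → ℕ.≤-trans
    (subst (ℕ._≤ lowerOffset n) (ℕ.m+n∸n≡m K 7) (ℕ.∸-monoˡ-≤ 7 (cbrt-max n (K ℕ.+ 7) N≤n)))
    (ℕ.m≤m+n _ 8)

  near : ∀ t → 1ℚᵘ ℚ.≤ frac t (t ℕ.+ 8) ℚ.+ frac 9 (t ℕ.+ 8) ×
               frac t (t ℕ.+ 8) ℚ.≤ 1ℚᵘ ℚ.+ frac 9 (t ℕ.+ 8)
  near t =
    (begin
      1ℚᵘ                                    ≃⟨ 1≃frac (t ℕ.+ 8) ⟩
      frac (suc (t ℕ.+ 8)) (t ℕ.+ 8)         ≡⟨ cong (λ z → frac z (t ℕ.+ 8)) (ℕ.+-suc t 8) ⟨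
      frac (t ℕ.+ 9) (t ℕ.+ 8)               ≃⟨ frac-+ t 9 (t ℕ.+ 8) ⟨
      frac t (t ℕ.+ 8) ℚ.+ frac 9 (t ℕ.+ 8)  ∎) ,
    (begin
      frac t (t ℕ.+ 8)                       ≤⟨ frac-≤ {t} {t ℕ.+ 8} {suc (t ℕ.+ 8)} {t ℕ.+ 8}
                                                  (ℕ.*-monoˡ-≤ _ (ℕ.≤-trans (ℕ.m≤m+n t 8) (ℕ.n≤1+n _))) ⟩
      frac (suc (t ℕ.+ 8)) (t ℕ.+ 8)         ≃⟨ 1≃frac (t ℕ.+ 8) ⟨
      1ℚᵘ                                    ≤⟨ ℚ.p≤p+q 1ℚᵘ (frac 9 (t ℕ.+ 8)) ⟩
      1ℚᵘ ℚ.+ frac 9 (t ℕ.+ 8)               ∎)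
    where open ℚ.≤-Reasoning

lower : ∃[ N ] ∀ (n : ℕ) .{{_ : NonZero n}} → N ℕ.≤ n →
  (fromℕ 1 + fromℚ (lowerRatio n ℚ.- 1ℚᵘ)) * α * n ^ (+ 4 / 3) ≤ fromℕ (h n)
-- From 16³ on, the offset is at least 16 - 7 = 9. Truncated roots err on the safe side here, so the
-- inequality holds at every index and ε is spare.
lower = cube 16 , λ n N≤n ε 0<ε → 0 , λ m _ → ℚ.≤-trans
  (rational-lower {t = lowerOffset n}
    {a = rootFloor 3 1 (2 ℕ.^ 7) (suc m)} {b = rootFloor 3 (n ℕ.^ 4) 1 (suc m)}
    {N = h n} {k = lowerOffset n ℕ.+ 8} {m = m}
    (Truncation.truncated-lower {n} {h n} {lowerOffset n} {suc (lowerOffset n ℕ.+ 8)}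
      {a = rootFloor 3 1 (2 ℕ.^ 7) (suc m)} {b = rootFloor 3 (n ℕ.^ 4) 1 (suc m)} {M = suc m}
      (bound n N≤n) (rootFloor-≤ 3 1 (2 ℕ.^ 7) (suc m)) (rootFloor-≤ 3 (n ℕ.^ 4) 1 (suc m))))
  (ℚ.p≤p+q (frac (h n) 0) ε {{ℚ.nonNegative (ℚ.<⇒≤ 0<ε)}})
  where
  bound : ∀ n → cube 16 ℕ.≤ n → cube (lowerOffset n) ℕ.* n ℕ.^ 4 ℕ.≤
          128 ℕ.* (cube (h n) ℕ.* cube (suc (lowerOffset n ℕ.+ 8)))
  bound n N≤n = subst₂ (λ x y → cube (lowerOffset n) ℕ.* x ℕ.≤ 128 ℕ.* (cube (h n) ℕ.* cube y))
    (sym (^4≡ n)) (ℕ.+-suc (lowerOffset n) 8)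
    (h-lower n (lowerOffset n) (ℕ.∸-monoˡ-≤ 7 16≤r)
      (subst (λ r → cube r ℕ.≤ n)
        (sym (ℕ.m∸n+n≡m (ℕ.≤-trans (ℕ.m≤m+n 7 9) 16≤r))) (cube-cbrt≤ n)))
    where
    16≤r : 16 ℕ.≤ cbrt n
    16≤r = cbrt-max n 16 N≤n

partSize : ℕ → ℕ
partSize n = cbrt (2 ℕ.* n)

-- This is (s + 15) / s for s = `partSize n`; at n = 0, where s vanishes, `ℕ.pred` supplies a
-- harmless value.
upperRatio : ℕ → ℚᵘ
upperRatio n = frac (partSize n ℕ.+ 15) (ℕ.pred (partSize n))

2≤partSize : ∀ {n} → 4 ℕ.≤ n → 2 ℕ.≤ partSize n
2≤partSize {n} 4≤n = cbrt-max (2 ℕ.* n) 2 (ℕ.*-monoʳ-≤ 2 4≤n)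

upperRatio→1 : IsLittleO1 (λ n → fromℚ (upperRatio n ℚ.- 1ℚᵘ))
upperRatio→1 = littleO upperRatio 15 (λ n → ℕ.pred (partSize n)) unbounded
  (4 , λ n 4≤n → near (partSize n) (2≤partSize 4≤n))
  where
  unbounded : Unbounded (λ n → ℕ.pred (partSize n))
  unbounded K = cube (suc K) , λ n N≤n → ℕ.pred-mono-≤
    (cbrt-max (2 ℕ.* n) (suc K) (ℕ.≤-trans N≤n (ℕ.m≤n*m n 2)))

  near : ∀ s → 2 ℕ.≤ s → 1ℚᵘ ℚ.≤ frac (s ℕ.+ 15) (ℕ.pred s) ℚ.+ frac 15 (ℕ.pred s) ×
                         frac (s ℕ.+ 15) (ℕ.pred s) ℚ.≤ 1ℚᵘ ℚ.+ frac 15 (ℕ.pred s)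
  near (suc σ) _ =
    ℚ.≤-trans (ℚ.p≤p+q 1ℚᵘ (frac 15 σ)) (ℚ.≤-trans (ℚ.≤-reflexive (ℚ.≃-sym ratio))
      (ℚ.p≤p+q (frac (suc σ ℕ.+ 15) σ) (frac 15 σ))) ,
    ℚ.≤-reflexive ratio
    where
    ratio : frac (suc σ ℕ.+ 15) σ ℚ.≃ 1ℚᵘ ℚ.+ frac 15 σ
    ratio = ℚ.≃-trans (ℚ.≃-sym (frac-+ (suc σ) 15 σ))
      (ℚ.+-congˡ (frac 15 σ) (ℚ.≃-sym (1≃frac σ)))

upper : ∃[ N ] ∀ (n : ℕ) .{{_ : NonZero n}} → N ℕ.≤ n →
  fromℕ (h n) ≤ (fromℕ 1 + fromℚ (upperRatio n ℚ.- 1ℚᵘ)) * β * n ^ (+ 4 / 3)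
-- From n = 4 on, 2 n ≥ 2³ and the parts have size at least 2. The constant `C` depends on n alone,
-- so the truncation error, at most C / (m + 1), drops below ε at large indices.
upper = 4 , λ n 4≤n ε 0<ε →
  let
    C = 3 ℕ.* (partSize n ℕ.+ 15) ℕ.* (n ℕ.* n ℕ.+ 2)
    K , vanish = frac-vanishes C ε 0<ε
  in
  K , λ m K≤m → rational-upper {v = partSize n ℕ.+ 15}
    {a = rootFloor 3 1 (2 ℕ.^ 5) (suc m)} {b = rootFloor 3 (n ℕ.^ 4) 1 (suc m)}
    {N = h n} {C = C} {σ = ℕ.pred (partSize n)} {m = m}
    (Truncation.truncated-upper {n} {h n} {suc (ℕ.pred (partSize n))} {partSize n ℕ.+ 15}
      {a = rootFloor 3 1 (2 ℕ.^ 5) (suc m)} {b = rootFloor 3 (n ℕ.^ 4) 1 (suc m)} {M = suc m}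
      (bound n 4≤n) (<-rootFloor 3 1 (2 ℕ.^ 5) (suc m)) (<-rootFloor 3 (n ℕ.^ 4) 1 (suc m)))
    (Truncation.truncation-error {n} {suc (ℕ.pred (partSize n))} {partSize n ℕ.+ 15}
      {a = rootFloor 3 1 (2 ℕ.^ 5) (suc m)} {b = rootFloor 3 (n ℕ.^ 4) 1 (suc m)} {M = suc m}
      (ℕ.≤-trans (s≤s z≤n) 4≤n) (s≤s z≤n) (s≤s z≤n)
      (rootFloor-≤ 3 1 (2 ℕ.^ 5) (suc m)) (rootFloor-≤ 3 (n ℕ.^ 4) 1 (suc m)))
    (vanish m K≤m)
  where
  bound : ∀ n → 4 ℕ.≤ n → 32 ℕ.* (cube (h n) ℕ.* cube (suc (ℕ.pred (partSize n)))) ℕ.≤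
          27 ℕ.* n ℕ.^ 4 ℕ.* cube (partSize n ℕ.+ 15)
  bound n 4≤n = subst₂ (λ x y → 32 ℕ.* (cube (h n) ℕ.* cube x) ℕ.≤ 27 ℕ.* y ℕ.* cube (s ℕ.+ 15))
    (sym (ℕ.suc-pred s {{ℕ.>-nonZero (ℕ.≤-trans (s≤s z≤n) (2≤partSize 4≤n))}})) (sym (^4≡ n))
    (h-upper n s (2≤partSize 4≤n) (cube-cbrt≤ (2 ℕ.* n))
      (ℕ.<⇒≤ (subst (λ z → 2 ℕ.* n ℕ.< cube z) (ℕ.+-comm 1 s) (<cube-cbrt (2 ℕ.* n)))))
    where
    s : ℕ
    s = partSize n

theorem3 : (∃[ δ ] IsLittleO1 δ × ∃[ N ] ∀ (n : ℕ) .{{_ : NonZero n}} → N ℕ.≤ n →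
    (fromℕ 1 + δ n) * α * n ^ (+ 4 / 3) ≤ fromℕ (h n))
    ×
    (∃[ δ ] IsLittleO1 δ × ∃[ N ] ∀ (n : ℕ) .{{_ : NonZero n}} → N ℕ.≤ n →
    fromℕ (h n) ≤ (fromℕ 1 + δ n) * β * n ^ (+ 4 / 3))
theorem3 =
  ((λ n → fromℚ (lowerRatio n ℚ.- 1ℚᵘ)) , lowerRatio→1 , lower) ,
  ((λ n → fromℚ (upperRatio n ℚ.- 1ℚᵘ)) , upperRatio→1 , upper)
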